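{- For every integer $k\ge1$, every finite graph $G$ has a good tree-decomposition that includes among its parts all those $k$-blocks of $G$ that are a part in some tree-decomposition of $G$ of adhesion $<k$.
   Context: A $k$-block of $G$ is a maximal set $X$ of at least $k$ vertices such that no two vertices $x,x'\in X$ can be separated in $G$ by fewer than $k$ vertices other than $x$ and $x'$. For a tree-decomposition $(T,(V_t)_{t\in T})$ of $G$, the sets $V_t$ are its parts and the sets $V_t\cap V_{t'}$ with $tt'\in E(T)$ are its adhesion sets; it has adhesion $<k$ if all adhesion sets have size $<k$. It is canonical if it is obtained by an assignment of tree-decompositions to graphs that commutes with graph isomorphisms; for a single graph $G$ this means invariance under automorphisms: for every automorphism $\alpha$ of $G$ there is an automorphism $\varphi$ of $T$ with $\alpha(V_t)=V_{\varphi(t)}$ for all $t\in T$. Given $k$, a tree-decomposition of $G$ is good if it is canonical, has adhesion $<k$, and distinguishes all the $k$-blocks of $G$ efficiently, i.e. any two distinct $k$-blocks are separated by an adhesion set of the tree-decomposition (they lie in parts on different sides of the corresponding tree edge) whose size is minimum among all the separators in $G$ between those two blocks. -}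

module Defs where

open import Data.Fin using (Fin; _≟_)
open import Data.Fin.Permutation using (Permutation′; _⟨$⟩ʳ_; _⟨$⟩ˡ_)
open import Data.Fin.Subset using (Subset; _∈_; _∉_; _⊆_; _∩_; ∣_∣; ⁅_⁆)
open import Data.List using (List; []; _∷_; length)
import Data.List.Membership.Propositional as List
open import Data.List.Relation.Unary.Any using (Any)
open import Data.List.Relation.Unary.Unique.Propositional using (Unique)
open import Data.Nat using (ℕ; _≤_; _<_)
open import Data.Product using (_×_; _,_; Σ-syntax; ∃-syntax)
open import Data.Sum using (_⊎_)
import Data.Sum as Sum
import Data.Product as Product
open import Data.Vec using (lookup; tabulate)
open import Function.Bundles using (_⇔_)
open import Level using (0ℓ)
open import Relation.Binary using (Rel; Decidable; Symmetric; Irreflexive)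
open import Relation.Binary.PropositionalEquality using (_≡_; _≢_)
open import Relation.Nullary using (¬_)
open import Relation.Nullary.Decidable using (_×-dec_; _⊎-dec_; ¬?)

-- A finite simple graph with vertex set Fin n.
record Graph (n : ℕ) : Set₁ where
  field
    Adj    : Rel (Fin n) 0ℓ
    adj?   : Decidable Adj
    sym    : Symmetric Adj
    irrefl : Irreflexive _≡_ Adj

open Graph public using (Adj)

data Walk {n : ℕ} (G : Graph n) : Fin n → Fin n → Set where
  [_]  : ∀ u → Walk G u u
  step : ∀ {u v w} → Adj G u v → Walk G v w → Walk G u w

vertices : ∀ {n} {G : Graph n} {u v} → Walk G u v → List (Fin n)
vertices [ u ]              = u ∷ []
vertices (step {u = u} _ p) = u ∷ vertices p

IsPath : ∀ {n} {G : Graph n} {u v} → Walk G u v → Set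
IsPath p = Unique (vertices p)

-- Every X–Y path meets S. Paths may consist of a single vertex, so this
-- forces X ∩ Y ⊆ S.
Separates : ∀ {n} → Graph n → Subset n → Subset n → Subset n → Set
Separates G S X Y =
  ∀ {x y} → x ∈ X → y ∈ Y → (p : Walk G x y) → IsPath p → Any (_∈ S) (vertices p)

Inseparable : ∀ {n} → ℕ → Graph n → Fin n → Fin n → Set
Inseparable {n} k G x y =
  ¬ (∃[ S ] ∣ S ∣ < k × x ∉ S × y ∉ S × Separates G S ⁅ x ⁆ ⁅ y ⁆)

IsInseparableSet : ∀ {n} → ℕ → Graph n → Subset n → Set
IsInseparableSet k G X =
  k ≤ ∣ X ∣ × (∀ {x y} → x ∈ X → y ∈ X → x ≢ y → Inseparable k G x y)

IsBlock : ∀ {n} → ℕ → Graph n → Subset n → Set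
IsBlock k G X =
  IsInseparableSet k G X × (∀ Y → IsInseparableSet k G Y → X ⊆ Y → Y ≡ X)

-- A cycle is a path on at least three vertices whose ends are adjacent.
Acyclic : ∀ {n} → Graph n → Set
Acyclic G =
  ∀ {u v} (p : Walk G u v) → IsPath p → 3 ≤ length (vertices p) → ¬ Adj G v u

record IsTree {m : ℕ} (T : Graph m) : Set where
  field
    node      : Fin m   -- trees are nonempty
    connected : ∀ s t → Walk T s t
    acyclic   : Acyclic T

record TreeDecomposition {n : ℕ} (G : Graph n) : Set₁ where
  field
    {size}    : ℕ
    tree      : Graph size
    isTree    : IsTree tree
    part      : Fin size → Subset n
    coverV    : ∀ v → ∃[ t ] v ∈ part t
    coverE    : ∀ {u v} → Adj G u v → ∃[ t ] u ∈ part t × v ∈ part t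
    connected : ∀ {r t} (p : Walk tree r t) → IsPath p →
                ∀ {s} → s List.∈ vertices p → part r ∩ part t ⊆ part s

  adhesionSet : ∀ {s t} → Adj tree s t → Subset n
  adhesionSet {s} {t} _ = part s ∩ part t

module _ {m : ℕ} (s t : Fin m) where

  SameEdge : Rel (Fin m) 0ℓ
  SameEdge u v = (u ≡ s × v ≡ t) ⊎ (u ≡ t × v ≡ s)

  deleteEdge : Graph m → Graph m
  deleteEdge T = record
    { Adj    = λ u v → Adj T u v × ¬ SameEdge u v
    ; adj?   = λ u v → Graph.adj? T u v ×-dec
                 ¬? ((u ≟ s ×-dec v ≟ t) ⊎-dec (u ≟ t ×-dec v ≟ s))
    ; sym    = λ (a , ¬e) → Graph.sym T a ,
                 λ e → ¬e (Sum.swap (Sum.map Product.swap Product.swap e))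
    ; irrefl = λ u≡v (a , _) → Graph.irrefl T u≡v a
    }

image : ∀ {n} → Permutation′ n → Subset n → Subset n
image α X = tabulate (λ v → lookup X (α ⟨$⟩ˡ v))

IsAutomorphism : ∀ {n} → Graph n → Permutation′ n → Set
IsAutomorphism G α = ∀ u v → Adj G u v ⇔ Adj G (α ⟨$⟩ʳ u) (α ⟨$⟩ʳ v)

module _ {n : ℕ} {G : Graph n} (D : TreeDecomposition G) where
  open TreeDecomposition D

  IsPart : Subset n → Set
  IsPart X = ∃[ t ] part t ≡ X

  HasAdhesionBelow : ℕ → Set
  HasAdhesionBelow k = ∀ {s t} (e : Adj tree s t) → ∣ adhesionSet e ∣ < k

  IsCanonical : Set
  IsCanonical =
    ∀ α → IsAutomorphism G α →
    ∃[ φ ] IsAutomorphism tree φ × (∀ t → image α (part t) ≡ part (φ ⟨$⟩ʳ t))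

  -- X and Y lie in parts on different sides of the tree edge st: X in a part
  -- of the component of tree − st containing s, Y in one of that containing t.
  OnDifferentSides : Fin size → Fin size → Subset n → Subset n → Set
  OnDifferentSides s t X Y =
    (∃[ a ] Walk (deleteEdge s t tree) s a × X ⊆ part a) ×
    (∃[ b ] Walk (deleteEdge s t tree) t b × Y ⊆ part b)

  DistinguishesEfficiently : Subset n → Subset n → Set
  DistinguishesEfficiently X Y =
    ∃[ s ] ∃[ t ] Σ[ e ∈ Adj tree s t ]
      OnDifferentSides s t X Y ×
      Separates G (adhesionSet e) X Y ×
      (∀ S → Separates G S X Y → ∣ adhesionSet e ∣ ≤ ∣ S ∣)

  record IsGood (k : ℕ) : Set where
    field
      canonical     : IsCanonical
      adhesion      : HasAdhesionBelow k
      distinguishes : ∀ {X Y} → IsBlock k G X → IsBlock k G Y → X ≢ Y →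
                      DistinguishesEfficiently X Y

-- For a pair of vertex sets that are oriented by all separations of order < k consider the
-- separations of least order distinguishing them; and for such a set X and a component C of
-- G - X with fewer than k neighbours consider the separations (A , B) with separator N(C),
-- C ⊆ A ∖ B and X ⊆ B. From each of these families keep the members that cross the fewest
-- pairs of vertex sets. Opposite corners of two crossing pairs together have strictly fewer
-- crossings than the pairs themselves. For two kept separations, either some opposite corners
-- are again members of their families, one each, or one pair of opposite corners lies in one
-- family and the other pair in the other family; both are impossible by minimality, so the
-- kept separations are nested. The choice commutes with automorphisms.
--
-- The consistent orientations of a nested set, adjacent when they differ in one separation,
-- form a tree, because a nested separation determines the two orientations that differ in it
-- alone. Intersecting the sides that an orientation points to gives the parts. A block X that
-- is a part in some tree-decomposition of adhesion < k has fewer than k vertices of attachment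
-- for every component C of G - X, so the kept separations cut every vertex outside X off from
-- X, and the part of the orientation towards X is X itself.

module Submission where

open import Defs
open import Data.Bool using (Bool; true; false; if_then_else_)
import Data.Bool as Bool
open import Data.Empty using (⊥-elim)
open import Data.Fin as Fin using (Fin; zero; suc)
import Data.Fin.Properties as Fin
open import Data.Fin.Permutation as Perm using (Permutation′; permutation; _⟨$⟩ʳ_; _⟨$⟩ˡ_; inverseˡ; inverseʳ)
open import Data.Fin.Subset using (Subset; _∈_; _∉_; _⊆_; _∩_; _∪_; ∁; ∣_∣; ⁅_⁆; ⊥; Nonempty)
open import Data.Fin.Subset.Properties
open import Data.List as List using (List; []; _∷_; map; length; filter; cartesianProduct; cartesianProductWith)
import Data.List.Membership.Propositional as List
open import Data.List.Membership.Propositional using () renaming (find to find∈)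
open import Data.List.Membership.Propositional.Properties using (∈-lookup; ∈-filter⁺; ∈-filter⁻; ∈-allFin; ∈-cartesianProduct⁺; ∈-cartesianProductWith⁺; ∈-map⁺)
open import Data.List.Membership.Propositional.Properties.WithK using (unique∧set⇒bag)
import Data.List.Properties as List
open import Data.List.Relation.Binary.BagAndSetEquality using (∼bag⇒↭)
import Data.List.Relation.Binary.Permutation.Propositional.Properties as Perm
open import Data.List.Relation.Unary.All as All using ([]; _∷_)
open import Data.List.Relation.Unary.AllPairs using ([]; _∷_)
open import Data.List.Relation.Unary.Any as Any using (Any; here; there; index)
open import Data.List.Relation.Unary.Any.Properties using (lookup-index)
open import Data.List.Relation.Unary.Unique.Propositional using (Unique)
import Data.List.Relation.Unary.Unique.Propositional.Properties as Unique
open import Data.Nat using (ℕ; zero; suc; _+_; _≤_; _<_; z≤n; s≤s; _<?_; _≤?_)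
import Data.Nat as ℕ
open import Data.Nat.Induction using (<-wellFounded)
open import Data.Nat.ListAction using (sum)
open import Data.Nat.ListAction.Properties using (sum-↭)
open import Data.Nat.Properties hiding (_≟_)
open import Data.Product using (_×_; _,_; proj₁; proj₂; ∃-syntax; Σ-syntax; swap)
import Data.Product.Properties as Product
open import Data.Sum using (_⊎_; inj₁; inj₂)
import Data.Sum as Sum
open import Data.Unit using (⊤; tt)
open import Data.Vec using ([]; _∷_; lookup; tabulate)
import Data.Vec.Properties as Vec
open import Function using (_∘_; mk⇔)
open import Function.Bundles using (Equivalence)
open import Induction.WellFounded using (Acc; acc)
open import Relation.Binary using (tri<; tri≈; tri>)
open import Relation.Binary.PropositionalEquality
open import Relation.Nullary using (¬_; Dec; yes; no; does; contradiction)
open import Relation.Nullary.Decidable using (map′; ¬?; decidable-stable; dec-true; _×-dec_; _⊎-dec_; _→-dec_)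
open import Relation.Unary using (Decidable)

private variable
  n : ℕ

-- Finite sets and finite search

∣p∪q∣+∣p∩q∣ : (p q : Subset n) → ∣ p ∪ q ∣ + ∣ p ∩ q ∣ ≡ ∣ p ∣ + ∣ q ∣
∣p∪q∣+∣p∩q∣ [] [] = refl
∣p∪q∣+∣p∩q∣ (true ∷ p) (true ∷ q)
  rewrite +-suc ∣ p ∪ q ∣ ∣ p ∩ q ∣ | +-suc ∣ p ∣ ∣ q ∣ = cong (2 +_) (∣p∪q∣+∣p∩q∣ p q)
∣p∪q∣+∣p∩q∣ (true ∷ p) (false ∷ q) = cong suc (∣p∪q∣+∣p∩q∣ p q)
∣p∪q∣+∣p∩q∣ (false ∷ p) (true ∷ q)
  rewrite +-suc ∣ p ∣ ∣ q ∣ = cong suc (∣p∪q∣+∣p∩q∣ p q)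
∣p∪q∣+∣p∩q∣ (false ∷ p) (false ∷ q) = ∣p∪q∣+∣p∩q∣ p q

p⊆q∧∣q∣≤∣p∣⇒q⊆p : {p q : Subset n} → p ⊆ q → ∣ q ∣ ≤ ∣ p ∣ → q ⊆ p
p⊆q∧∣q∣≤∣p∣⇒q⊆p {p = p} p⊆q le {x} x∈q with x ∈? p
... | yes x∈p = x∈p
... | no  x∉p = contradiction (p⊂q⇒∣p∣<∣q∣ (p⊆q , x , x∈q , x∉p)) (≤⇒≯ le)

∪-lub : {p q r : Subset n} → p ⊆ r → q ⊆ r → p ∪ q ⊆ r
∪-lub {p = p} {q} p⊆r q⊆r x∈ with x∈p∪q⁻ p q x∈
... | inj₁ x∈p = p⊆r x∈p
... | inj₂ x∈q = q⊆r x∈q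

⁅x⁆⊆ : {x : Fin n} {p : Subset n} → x ∈ p → ⁅ x ⁆ ⊆ p
⁅x⁆⊆ {p = p} x∈p y∈ = subst (_∈ p) (sym (x∈⁅y⁆⇒x≡y _ y∈)) x∈p

⊈⇒∃ : {p q : Subset n} → ¬ (p ⊆ q) → ∃[ x ] x ∈ p × x ∉ q
⊈⇒∃ {p = p} {q} p⊈q with nonempty? (p ∩ ∁ q)
... | yes (x , x∈) = let x∈p , x∈∁q = x∈p∩q⁻ p (∁ q) x∈ in x , x∈p , x∈∁p⇒x∉p x∈∁q
... | no  empty    = contradiction
  (λ {x} x∈p → x∉∁p⇒x∈p λ x∈∁q → empty (x , x∈p∩q⁺ (x∈p , x∈∁q))) p⊈q

module _ {P : Fin n → Set} (P? : Decidable P) where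

  comprehension : Subset n
  comprehension = tabulate (does ∘ P?)

  ∈-comprehension⁺ : ∀ {v} → P v → v ∈ comprehension
  ∈-comprehension⁺ {v} Pv =
    Vec.lookup⇒[]= v _ (trans (Vec.lookup∘tabulate _ v) (dec-true (P? v) Pv))

  ∈-comprehension⁻ : ∀ {v} → v ∈ comprehension → P v
  ∈-comprehension⁻ {v} v∈ with P? v | trans (sym (Vec.lookup∘tabulate (does ∘ P?) v)) (Vec.[]=⇒lookup v∈)
  ... | yes Pv | _ = Pv
  ... | no  _  | ()

abstract

  allSubsets? : {P : Subset n → Set} → Decidable P → Dec (∀ X → P X)
  allSubsets? P? = map′
    (λ none X → decidable-stable (P? X) λ ¬PX → none (X , ¬PX))
    (λ all (X , ¬PX) → ¬PX (all X))
    (¬? (anySubset? (¬? ∘ P?)))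

-- Well-founded descent on the value of `f`: as long as `smaller?` finds a better candidate, the
-- search moves there.
argmin : {A : Set} {P : A → Set} (f : A → ℕ) →
         (∀ m → Dec (∃[ a ] P a × f a < m)) →
         ∃[ a ] P a → ∃[ a ] P a × (∀ b → P b → f a ≤ f b)
argmin {A} {P} f smaller? (a , Pa) = go a Pa (<-wellFounded (f a))
  where
  go : ∀ a → P a → Acc _<_ (f a) → ∃[ a ] P a × (∀ b → P b → f a ≤ f b)
  go a Pa (acc rec) with smaller? (f a)
  ... | yes (b , Pb , fb<fa) = go b Pb (rec fb<fa)
  ... | no  none = a , Pa , λ b Pb → ≮⇒≥ λ fb<fa → none (b , Pb , fb<fa)

bools : List Bool
bools = true ∷ false ∷ []

subsets : ∀ n → List (Subset n)
subsets zero    = [] ∷ []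
subsets (suc n) = cartesianProductWith _∷_ bools (subsets n)

∈-subsets : (X : Subset n) → X List.∈ subsets n
∈-subsets []          = here refl
∈-subsets (true  ∷ X) = ∈-cartesianProductWith⁺ _∷_ {xs = bools} (here refl) (∈-subsets X)
∈-subsets (false ∷ X) = ∈-cartesianProductWith⁺ _∷_ {xs = bools} (there (here refl)) (∈-subsets X)

subsets-unique : ∀ n → Unique (subsets n)
subsets-unique zero    = [] ∷ []
subsets-unique (suc n) =
  Unique.cartesianProductWith⁺ _∷_ Vec.∷-injective (((λ ()) ∷ []) ∷ ([] ∷ [])) (subsets-unique n)

-- Sums over lists

module _ {A : Set} where

  sum-map-+ : (f g : A → ℕ) (xs : List A) →
              sum (map (λ a → f a + g a) xs) ≡ sum (map f xs) + sum (map g xs)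
  sum-map-+ f g []       = refl
  sum-map-+ f g (x ∷ xs) = begin
    f x + g x + sum (map (λ a → f a + g a) xs)  ≡⟨ cong (f x + g x +_) (sum-map-+ f g xs) ⟩
    f x + g x + (F + G)                         ≡⟨ +-assoc (f x) (g x) (F + G) ⟩
    f x + (g x + (F + G))                       ≡⟨ cong (f x +_) (sym (+-assoc (g x) F G)) ⟩
    f x + (g x + F + G)                         ≡⟨ cong (λ m → f x + (m + G)) (+-comm (g x) F) ⟩
    f x + (F + g x + G)                         ≡⟨ cong (f x +_) (+-assoc F (g x) G) ⟩
    f x + (F + (g x + G))                       ≡⟨ sym (+-assoc (f x) F (g x + G)) ⟩
    f x + F + (g x + G)                         ∎
    where
    open ≡-Reasoning
    F G : ℕ
    F = sum (map f xs)
    G = sum (map g xs)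

  sum-map-≤ : {f g : A → ℕ} → (∀ a → f a ≤ g a) → ∀ xs → sum (map f xs) ≤ sum (map g xs)
  sum-map-≤ f≤g []       = z≤n
  sum-map-≤ f≤g (x ∷ xs) = +-mono-≤ (f≤g x) (sum-map-≤ f≤g xs)

  sum-map-< : {f g : A → ℕ} → (∀ a → f a ≤ g a) → ∀ {a xs} → a List.∈ xs → f a < g a →
              sum (map f xs) < sum (map g xs)
  sum-map-< f≤g {xs = _ ∷ xs} (here refl) lt = +-mono-<-≤ lt (sum-map-≤ f≤g xs)
  sum-map-< f≤g {xs = x ∷ _}  (there a∈)  lt = +-mono-≤-< (f≤g x) (sum-map-< f≤g a∈ lt)

  -- As `h` is a bijection, `map h xs` is again duplicate-free and complete, hence a permutation of
  -- `xs`.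
  sum-map-reindex : {xs : List A} → Unique xs → (∀ a → a List.∈ xs) →
                    (h h⁻¹ : A → A) → (∀ a → h (h⁻¹ a) ≡ a) → (∀ a → h⁻¹ (h a) ≡ a) →
                    (f : A → ℕ) → sum (map (f ∘ h) xs) ≡ sum (map f xs)
  sum-map-reindex {xs} unique complete h h⁻¹ hh⁻¹ h⁻¹h f = begin
    sum (map (f ∘ h) xs)    ≡⟨ cong sum (List.map-∘ xs) ⟩
    sum (map f (map h xs))  ≡⟨ sum-↭ (Perm.map⁺ f map-h↭) ⟩
    sum (map f xs)          ∎
    where
    open ≡-Reasoning
    h-injective : ∀ {a b} → h a ≡ h b → a ≡ b
    h-injective {a} {b} eq = trans (sym (h⁻¹h a)) (trans (cong h⁻¹ eq) (h⁻¹h b))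
    map-h↭ = ∼bag⇒↭ (unique∧set⇒bag (Unique.map⁺ h-injective unique) unique λ {a} →
      mk⇔ (λ _ → complete a)
          (λ _ → subst (List._∈ map h xs) (hh⁻¹ a) (∈-map⁺ h (complete (h⁻¹ a)))))

-- The lattice of pairs of vertex sets

-- Arbitrary pairs of vertex sets, not only separations. Crossings are counted against all of them,
-- so the count refers to no graph and every permutation of the vertices preserves it.
Pair : ℕ → Set
Pair n = Subset n × Subset n

infix 4 _≼_
infixl 7 _∧ˢ_ _∨ˢ_
infix 8 _⋆

_≼_ : Pair n → Pair n → Set
s ≼ t = proj₁ s ⊆ proj₁ t × proj₂ t ⊆ proj₂ s

_⋆ : Pair n → Pair n
s ⋆ = swap s

_∧ˢ_ _∨ˢ_ : Pair n → Pair n → Pair n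
s ∧ˢ t = proj₁ s ∩ proj₁ t , proj₂ s ∪ proj₂ t
s ∨ˢ t = proj₁ s ∪ proj₁ t , proj₂ s ∩ proj₂ t

≼-trans : {r s t : Pair n} → r ≼ s → s ≼ t → r ≼ t
≼-trans (A⊆C , D⊆B) (C⊆E , F⊆D) = ⊆-trans A⊆C C⊆E , ⊆-trans F⊆D D⊆B

≼-antisym : {s t : Pair n} → s ≼ t → t ≼ s → s ≡ t
≼-antisym (A⊆C , D⊆B) (C⊆A , B⊆D) = cong₂ _,_ (⊆-antisym A⊆C C⊆A) (⊆-antisym B⊆D D⊆B)

_≼?_ : (s t : Pair n) → Dec (s ≼ t)
s ≼? t = proj₁ s ⊆? proj₁ t ×-dec proj₂ t ⊆? proj₂ s

∧≼ˡ : (s t : Pair n) → s ∧ˢ t ≼ s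
∧≼ˡ (A , B) (P , Q) = p∩q⊆p A P , p⊆p∪q Q

∧≼ʳ : (s t : Pair n) → s ∧ˢ t ≼ t
∧≼ʳ (A , B) (P , Q) = p∩q⊆q A P , q⊆p∪q B Q

∧-glb : {r s t : Pair n} → r ≼ s → r ≼ t → r ≼ s ∧ˢ t
∧-glb (R⊆A , B⊆S) (R⊆P , Q⊆S) = (λ x∈ → x∈p∩q⁺ (R⊆A x∈ , R⊆P x∈)) , ∪-lub B⊆S Q⊆S

∧ˢ-comm : (s t : Pair n) → s ∧ˢ t ≡ t ∧ˢ s
∧ˢ-comm (A , B) (P , Q) = cong₂ _,_ (∩-comm A P) (∪-comm B Q)

∨ˢ-comm : (s t : Pair n) → s ∨ˢ t ≡ t ∨ˢ s
∨ˢ-comm (A , B) (P , Q) = cong₂ _,_ (∪-comm A P) (∩-comm B Q)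

-- swap also reverses _≼_, so the last two cases say t ≼ s and t ⋆ ≼ s.
data Nested (s t : Pair n) : Set where
  ≼⁺⁺ : s ≼ t → Nested s t
  ≼⁺⁻ : s ≼ t ⋆ → Nested s t
  ≼⁻⁻ : s ⋆ ≼ t ⋆ → Nested s t
  ≼⁻⁺ : s ⋆ ≼ t → Nested s t

nested? : (s t : Pair n) → Dec (Nested s t)
nested? s t with s ≼? t | s ≼? (t ⋆) | (s ⋆) ≼? (t ⋆) | (s ⋆) ≼? t
... | yes le | _      | _      | _      = yes (≼⁺⁺ le)
... | no _   | yes le | _      | _      = yes (≼⁺⁻ le)
... | no _   | no _   | yes le | _      = yes (≼⁻⁻ le)
... | no _   | no _   | no _   | yes le = yes (≼⁻⁺ le)
... | no ¬1  | no ¬2  | no ¬3  | no ¬4  = no λ where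
  (≼⁺⁺ le) → ¬1 le
  (≼⁺⁻ le) → ¬2 le
  (≼⁻⁻ le) → ¬3 le
  (≼⁻⁺ le) → ¬4 le

nested-sym : {s t : Pair n} → Nested s t → Nested t s
nested-sym (≼⁺⁺ le) = ≼⁻⁻ (swap le)
nested-sym (≼⁺⁻ le) = ≼⁺⁻ (swap le)
nested-sym (≼⁻⁻ le) = ≼⁺⁺ (swap le)
nested-sym (≼⁻⁺ le) = ≼⁻⁺ (swap le)

nested-⋆ʳ : {s t : Pair n} → Nested s t → Nested s (t ⋆)
nested-⋆ʳ (≼⁺⁺ le) = ≼⁺⁻ le
nested-⋆ʳ (≼⁺⁻ le) = ≼⁺⁺ le
nested-⋆ʳ (≼⁻⁻ le) = ≼⁻⁺ le
nested-⋆ʳ (≼⁻⁺ le) = ≼⁻⁻ le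

nested-⋆ˡ : {s t : Pair n} → Nested s t → Nested (s ⋆) t
nested-⋆ˡ = nested-sym ∘ nested-⋆ʳ ∘ nested-sym

-- The meet lies below `s` and `t`, so it inherits any relation that puts one of them below `r` or
-- `r ⋆`. Otherwise each of `s` and `t` lies above `r` or `r ⋆`: if the same one, it is a lower
-- bound of the meet; if not, the two relations chain to `s ⋆ ≼ t`, and `s` and `t` would be nested.
nested-∧ : (r s t : Pair n) → ¬ Nested s t → Nested r s → Nested r t → Nested r (s ∧ˢ t)
nested-∧ r s t cross rs rt = go rs rt
  where
  below-s : {u : Pair _} → s ≼ u → s ∧ˢ t ≼ u
  below-s = ≼-trans {r = s ∧ˢ t} (∧≼ˡ s t)
  below-t : {u : Pair _} → t ≼ u → s ∧ˢ t ≼ u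
  below-t = ≼-trans {r = s ∧ˢ t} (∧≼ʳ s t)
  go : Nested r s → Nested r t → Nested r (s ∧ˢ t)
  go (≼⁺⁻ le) _         = ≼⁺⁻ (swap (below-s (swap le)))
  go (≼⁻⁻ le) _         = ≼⁻⁻ (swap (below-s (swap le)))
  go _ (≼⁺⁻ le)         = ≼⁺⁻ (swap (below-t (swap le)))
  go _ (≼⁻⁻ le)         = ≼⁻⁻ (swap (below-t (swap le)))
  go (≼⁺⁺ le) (≼⁺⁺ le′) = ≼⁺⁺ (∧-glb {r = r} {s} {t} le le′)
  go (≼⁻⁺ le) (≼⁻⁺ le′) = ≼⁻⁺ (∧-glb {r = r ⋆} {s} {t} le le′)
  go (≼⁺⁺ le) (≼⁻⁺ le′) = contradiction (≼⁻⁺ (≼-trans {s = r ⋆} (swap le) le′)) cross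
  go (≼⁻⁺ le) (≼⁺⁺ le′) = contradiction (≼⁻⁺ (≼-trans {s = r} (swap le) le′)) cross

nested-∨ : (r s t : Pair n) → ¬ Nested s t → Nested r s → Nested r t → Nested r (s ∨ˢ t)
nested-∨ r s t cross rs rt = nested-⋆ʳ
  (nested-∧ r (s ⋆) (t ⋆) (cross ∘ nested-⋆ˡ ∘ nested-⋆ʳ) (nested-⋆ʳ rs) (nested-⋆ʳ rt))

-- If `s` lies below `r` or `r ⋆`, so does the meet; if `s` lies above one of them, so does the
-- join. This handles the pairs `r` that cross only `t`.
nested-∧⊎∨ˡ : (r s t : Pair n) → Nested r s → Nested r (s ∧ˢ t) ⊎ Nested r (s ∨ˢ t)
nested-∧⊎∨ˡ r s t = λ where
    (≼⁺⁻ le) → inj₁ (≼⁺⁻ (swap (below-s (swap le))))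
    (≼⁻⁻ le) → inj₁ (≼⁻⁻ (swap (below-s (swap le))))
    (≼⁺⁺ le) → inj₂ (≼⁺⁺ (swap (above-s (swap le))))
    (≼⁻⁺ le) → inj₂ (≼⁻⁺ (swap (above-s (swap le))))
  where
  below-s : {u : Pair _} → s ≼ u → s ∧ˢ t ≼ u
  below-s = ≼-trans {r = s ∧ˢ t} (∧≼ˡ s t)
  above-s : {u : Pair _} → s ⋆ ≼ u → s ⋆ ∧ˢ t ⋆ ≼ u
  above-s = ≼-trans {r = s ⋆ ∧ˢ t ⋆} (∧≼ˡ (s ⋆) (t ⋆))

nested-∧⊎∨ʳ : (r s t : Pair n) → Nested r t → Nested r (s ∧ˢ t) ⊎ Nested r (s ∨ˢ t)
nested-∧⊎∨ʳ r s t rt = subst₂ (λ u v → Nested r u ⊎ Nested r v)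
  (∧ˢ-comm t s) (∨ˢ-comm t s)
  (nested-∧⊎∨ˡ r t s rt)

-- Crossing numbers

pairs : ∀ n → List (Pair n)
pairs n = cartesianProduct (subsets n) (subsets n)

∈-pairs : (s : Pair n) → s List.∈ pairs n
∈-pairs (A , B) = ∈-cartesianProduct⁺ (∈-subsets A) (∈-subsets B)

pairs-unique : ∀ n → Unique (pairs n)
pairs-unique n = Unique.cartesianProduct⁺ (subsets-unique n) (subsets-unique n)

χ : Pair n → Pair n → ℕ
χ r s = if does (nested? r s) then 0 else 1

χ≤1 : (r s : Pair n) → χ r s ≤ 1
χ≤1 r s with nested? r s
... | yes _ = z≤n
... | no  _ = ≤-refl

χ≡0 : {r s : Pair n} → Nested r s → χ r s ≡ 0
χ≡0 {r = r} {s} rs with nested? r s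
... | yes _  = refl
... | no ¬rs = contradiction rs ¬rs

χ≡1 : {r s : Pair n} → ¬ Nested r s → χ r s ≡ 1
χ≡1 {r = r} {s} ¬rs with nested? r s
... | yes rs = contradiction rs ¬rs
... | no _   = refl

χ-cong : {r s r′ s′ : Pair n} →
         (Nested r s → Nested r′ s′) → (Nested r′ s′ → Nested r s) → χ r s ≡ χ r′ s′
χ-cong {r = r} {s} to from with nested? r s
... | yes rs = sym (χ≡0 (to rs))
... | no ¬rs = sym (χ≡1 (¬rs ∘ from))

crossings : Pair n → ℕ
crossings {n} s = sum (map (λ r → χ r s) (pairs n))

crossings-⋆ : (s : Pair n) → crossings (s ⋆) ≡ crossings s
crossings-⋆ s = ≤-antisym
  (sum-map-≤ (λ r → ≤-reflexive (χ-cong {r = r} {s ⋆} nested-⋆ʳ nested-⋆ʳ)) (pairs _))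
  (sum-map-≤ (λ r → ≤-reflexive (χ-cong {r = r} {s} nested-⋆ʳ nested-⋆ʳ)) (pairs _))

-- Submodularity, proved for each `r` separately: an `r` crossing one corner crosses `s` or `t`, and
-- an `r` crossing both corners crosses both. It is strict at `r = s`, which crosses `t` but is
-- nested with both corners.
crossings-corners : (s t : Pair n) → ¬ Nested s t →
                    crossings (s ∧ˢ t) + crossings (s ∨ˢ t) < crossings s + crossings t
crossings-corners {n} s t cross =
  subst₂ _<_ (sum-map-+ (λ r → χ r (s ∧ˢ t)) (λ r → χ r (s ∨ˢ t)) (pairs n))
             (sum-map-+ (λ r → χ r s) (λ r → χ r t) (pairs n))
             (sum-map-< pointwise (∈-pairs s) at-s)
  where
  one-nested : ∀ r → Nested r (s ∧ˢ t) ⊎ Nested r (s ∨ˢ t) → χ r (s ∧ˢ t) + χ r (s ∨ˢ t) ≤ 1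
  one-nested r (inj₁ r∧) rewrite χ≡0 r∧ = χ≤1 r (s ∨ˢ t)
  one-nested r (inj₂ r∨) rewrite χ≡0 r∨ | +-identityʳ (χ r (s ∧ˢ t)) = χ≤1 r (s ∧ˢ t)

  pointwise : ∀ r → χ r (s ∧ˢ t) + χ r (s ∨ˢ t) ≤ χ r s + χ r t
  pointwise r with nested? r s | nested? r t
  ... | yes rs | yes rt
    rewrite χ≡0 (nested-∧ r s t cross rs rt) | χ≡0 (nested-∨ r s t cross rs rt) = z≤n
  ... | yes rs | no _   = one-nested r (nested-∧⊎∨ˡ r s t rs)
  ... | no _   | yes rt = one-nested r (nested-∧⊎∨ʳ r s t rt)
  ... | no _   | no _   = +-mono-≤ (χ≤1 r (s ∧ˢ t)) (χ≤1 r (s ∨ˢ t))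

  at-s : χ s (s ∧ˢ t) + χ s (s ∨ˢ t) < χ s s + χ s t
  at-s rewrite χ≡0 {r = s} {s ∧ˢ t} (≼⁻⁻ (swap (∧≼ˡ s t)))
             | χ≡0 {r = s} {s ∨ˢ t} (≼⁺⁺ (swap (∧≼ˡ (s ⋆) (t ⋆))))
             | χ≡1 cross = m≤n+m 1 (χ s s)

-- Members of a family with the fewest crossings

abstract

  any-pair? : {P : Pair n → Set} → Decidable P → Dec (∃[ s ] P s)
  any-pair? P? = map′ (λ (A , B , Ps) → (A , B) , Ps) (λ ((A , B) , Ps) → A , B , Ps)
    (anySubset? λ A → anySubset? λ B → P? (A , B))

abstract

  all-pairs? : {P : Pair n → Set} → Decidable P → Dec (∀ s → P s)
  all-pairs? P? = map′ (λ f (A , B) → f A B) (λ f A B → f (A , B))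
    (allSubsets? λ A → allSubsets? λ B → P? (A , B))

record Least {n : ℕ} (F : Pair n → Set) (s : Pair n) : Set where
  field
    member : F s
    least  : ∀ u → F u → crossings s ≤ crossings u

least? : ∀ {n} {F : Pair n → Set} → Decidable F → Decidable (Least F)
least? F? s = map′
  (λ (Fs , l) → record { member = Fs ; least = l })
  (λ L → Least.member L , Least.least L)
  (F? s ×-dec all-pairs? λ u → F? u →-dec crossings s ≤? crossings u)

-- A competitor `u` in `F′` is pulled back by `g`, which keeps its crossings, and is compared with
-- `s` in `F`.
least-map : ∀ {n} {F F′ : Pair n → Set} (f g : Pair n → Pair n) →
            (∀ u → crossings (f u) ≡ crossings u) → (∀ u → crossings (g u) ≡ crossings u) →
            (∀ {u} → F u → F′ (f u)) → (∀ {u} → F′ u → F (g u)) →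
            ∀ {s} → Least F s → Least F′ (f s)
least-map f g f≡ g≡ to from {s} L = record
  { member = to (Least.member L)
  ; least  = λ u F′u → subst₂ _≤_ (sym (f≡ s)) (g≡ u) (Least.least L (g u) (from F′u))
  }

least-⋆ : ∀ {n} {F F′ : Pair n → Set} → (∀ {u} → F u → F′ (u ⋆)) → (∀ {u} → F′ u → F (u ⋆)) →
          ∀ {s} → Least F s → Least F′ (s ⋆)
least-⋆ = least-map _⋆ _⋆ crossings-⋆ crossings-⋆

least-exists : ∀ {n} {F : Pair n → Set} → Decidable F → ∃[ s ] F s → ∃[ s ] Least F s
least-exists F? some =
  let s , Fs , minimal = argmin crossings (λ m → any-pair? λ s → F? s ×-dec crossings s <? m) some
  in s , record { member = Fs ; least = minimal }

module _ {n : ℕ} {F F′ : Pair n → Set} {s t : Pair n} (L : Least F s) (L′ : Least F′ t) where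

  -- Each corner has at least as many crossings as the least member of its family, which contradicts
  -- the strict inequality for corners of a crossing pair.
  nested-if-corners : F (s ∧ˢ t) → F′ (s ∨ˢ t) → Nested s t
  nested-if-corners ∧∈ ∨∈ = decidable-stable (nested? s t) λ cross →
    <⇒≱ (crossings-corners s t cross) (+-mono-≤ (Least.least L _ ∧∈) (Least.least L′ _ ∨∈))

  nested-if-corners′ : F′ (s ∧ˢ t) → F (s ∨ˢ t) → Nested s t
  nested-if-corners′ ∧∈ ∨∈ = decidable-stable (nested? s t) λ cross →
    <⇒≱ (crossings-corners s t cross)
      (≤-trans (≤-reflexive (+-comm (crossings s) (crossings t)))
               (+-mono-≤ (Least.least L′ _ ∧∈) (Least.least L _ ∨∈)))

-- If s and t crossed, each pair of opposite corners would force one of s and t to have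
-- strictly more crossings than the other.
nested-if-all-corners : ∀ {n} {F F′ : Pair n → Set} {s t : Pair n} → Least F s → Least F′ (t ⋆) →
                        F (s ∧ˢ t) → F (s ∨ˢ t) → F′ (s ∧ˢ t ⋆) → F′ (s ∨ˢ t ⋆) → Nested s t
nested-if-all-corners {s = s} {t} L L′ F∧ F∨ F′∧ F′∨ = decidable-stable (nested? s t) λ cross →
  <-asym
    (+-cancelˡ-< (crossings s) _ _
      (≤-<-trans (+-mono-≤ (Least.least L _ F∧) (Least.least L _ F∨)) (crossings-corners s t cross)))
    (subst (_< crossings s) (crossings-⋆ t)
      (+-cancelʳ-< (crossings (t ⋆)) _ _
        (≤-<-trans (+-mono-≤ (Least.least L′ _ F′∧) (Least.least L′ _ F′∨))
                   (crossings-corners s (t ⋆) (cross ∘ nested-⋆ʳ)))))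

-- Separations of a graph

order : ∀ {n} → Pair n → ℕ
order (A , B) = ∣ A ∩ B ∣

order-⋆ : ∀ {n} (s : Pair n) → order (s ⋆) ≡ order s
order-⋆ (A , B) = cong ∣_∣ (∩-comm B A)

module _ {n : ℕ} (G : Graph n) where

  -- With equality included, one condition expresses both that the two sides of a separation cover
  -- all vertices and that no edge leads from one strict side to the other.
  Close : Fin n → Fin n → Set
  Close u v = u ≡ v ⊎ Adj G u v

  record IsSeparation (s : Pair n) : Set where
    constructor mkSeparation
    field
      together : ∀ u v → Close u v → (u ∈ proj₁ s × v ∈ proj₁ s) ⊎ (u ∈ proj₂ s × v ∈ proj₂ s)

  open IsSeparation public

  isSeparation? : Decidable IsSeparation
  isSeparation? (A , B) = map′ mkSeparation together (Fin.all? λ u → Fin.all? λ v →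
    (u Fin.≟ v ⊎-dec Graph.adj? G u v) →-dec
    ((u ∈? A ×-dec v ∈? A) ⊎-dec (u ∈? B ×-dec v ∈? B)))

  Split : Subset n → Subset n → Pair n → Set
  Split X Y s = IsSeparation s × X ⊆ proj₁ s × Y ⊆ proj₂ s

  split? : ∀ X Y → Decidable (Split X Y)
  split? X Y s = isSeparation? s ×-dec X ⊆? proj₁ s ×-dec Y ⊆? proj₂ s

  -- Connectedness as seen by separations.
  Uncut : Subset n → Set
  Uncut C = ∀ s → IsSeparation s → C ∩ (proj₁ s ∩ proj₂ s) ⊆ ⊥ → C ⊆ proj₁ s ⊎ C ⊆ proj₂ s

  uncut? : Decidable Uncut
  uncut? C = all-pairs? λ s → isSeparation? s →-dec C ∩ (proj₁ s ∩ proj₂ s) ⊆? ⊥ →-dec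
    (C ⊆? proj₁ s ⊎-dec C ⊆? proj₂ s)

module _ {n : ℕ} {G : Graph n} where

  separation-⋆ : ∀ {s} → IsSeparation G s → IsSeparation G (s ⋆)
  separation-⋆ sep = mkSeparation λ u v close → Sum.swap (together sep u v close)

  separation-∧ : ∀ {s t} → IsSeparation G s → IsSeparation G t → IsSeparation G (s ∧ˢ t)
  separation-∧ {s} {t} sep-s sep-t = mkSeparation corner
    where
    corner : ∀ u v → Close G u v → (u ∈ proj₁ (s ∧ˢ t) × v ∈ proj₁ (s ∧ˢ t)) ⊎
                                   (u ∈ proj₂ (s ∧ˢ t) × v ∈ proj₂ (s ∧ˢ t))
    corner u v close with together sep-s u v close | together sep-t u v close
    ... | inj₁ (uA , vA) | inj₁ (uP , vP) = inj₁ (x∈p∩q⁺ (uA , uP) , x∈p∩q⁺ (vA , vP))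
    ... | inj₂ (uB , vB) | _              = inj₂ (x∈p∪q⁺ (inj₁ uB) , x∈p∪q⁺ (inj₁ vB))
    ... | inj₁ _         | inj₂ (uQ , vQ) = inj₂ (x∈p∪q⁺ (inj₂ uQ) , x∈p∪q⁺ (inj₂ vQ))

  separation-∨ : ∀ {s t} → IsSeparation G s → IsSeparation G t → IsSeparation G (s ∨ˢ t)
  separation-∨ sep-s sep-t = separation-⋆ (separation-∧ (separation-⋆ sep-s) (separation-⋆ sep-t))

  separation-cover : ∀ {s} → IsSeparation G s → ∀ v → v ∈ proj₁ s ⊎ v ∈ proj₂ s
  separation-cover sep v = Sum.map proj₁ proj₁ (together sep v v (inj₁ refl))

  -- The separators of the two corners have the same union and the same intersection as the
  -- separators of `s` and `t`; inclusion-exclusion then gives equality of the sums.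
  order-corners : ∀ {s t} → IsSeparation G s → IsSeparation G t →
                  order (s ∧ˢ t) + order (s ∨ˢ t) ≡ order s + order t
  order-corners {A , B} {P , Q} sep-s sep-t = begin
    ∣ L ∣ + ∣ R ∣          ≡⟨ sym (∣p∪q∣+∣p∩q∣ L R) ⟩
    ∣ L ∪ R ∣ + ∣ L ∩ R ∣  ≡⟨ cong₂ _+_ (cong ∣_∣ (⊆-antisym (∪-lub L⊆ R⊆) (∪-lub U⊆ W⊆))) (cong ∣_∣ (⊆-antisym L∩R⊆ U∩W⊆)) ⟩
    ∣ U ∪ W ∣ + ∣ U ∩ W ∣  ≡⟨ ∣p∪q∣+∣p∩q∣ U W ⟩
    ∣ U ∣ + ∣ W ∣          ∎
    where
    open ≡-Reasoning
    L R U W : Subset n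
    L = (A ∩ P) ∩ (B ∪ Q)
    R = (A ∪ P) ∩ (B ∩ Q)
    U = A ∩ B
    W = P ∩ Q
    L⊆ : L ⊆ U ∪ W
    L⊆ v∈ with x∈p∩q⁻ (A ∩ P) (B ∪ Q) v∈
    ... | v∈AP , v∈BQ with x∈p∩q⁻ A P v∈AP | x∈p∪q⁻ B Q v∈BQ
    ...   | vA , _  | inj₁ vB = x∈p∪q⁺ (inj₁ (x∈p∩q⁺ (vA , vB)))
    ...   | _  , vP | inj₂ vQ = x∈p∪q⁺ (inj₂ (x∈p∩q⁺ (vP , vQ)))
    R⊆ : R ⊆ U ∪ W
    R⊆ v∈ with x∈p∩q⁻ (A ∪ P) (B ∩ Q) v∈
    ... | v∈AP , v∈BQ with x∈p∪q⁻ A P v∈AP | x∈p∩q⁻ B Q v∈BQ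
    ...   | inj₁ vA | vB , _  = x∈p∪q⁺ (inj₁ (x∈p∩q⁺ (vA , vB)))
    ...   | inj₂ vP | _  , vQ = x∈p∪q⁺ (inj₂ (x∈p∩q⁺ (vP , vQ)))
    U⊆ : U ⊆ L ∪ R
    U⊆ v∈ with x∈p∩q⁻ A B v∈ | separation-cover sep-t _
    ... | vA , vB | inj₁ vP = x∈p∪q⁺ (inj₁ (x∈p∩q⁺ (x∈p∩q⁺ (vA , vP) , x∈p∪q⁺ (inj₁ vB))))
    ... | vA , vB | inj₂ vQ = x∈p∪q⁺ (inj₂ (x∈p∩q⁺ (x∈p∪q⁺ (inj₁ vA) , x∈p∩q⁺ (vB , vQ))))
    W⊆ : W ⊆ L ∪ R
    W⊆ v∈ with x∈p∩q⁻ P Q v∈ | separation-cover sep-s _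
    ... | vP , vQ | inj₁ vA = x∈p∪q⁺ (inj₁ (x∈p∩q⁺ (x∈p∩q⁺ (vA , vP) , x∈p∪q⁺ (inj₂ vQ))))
    ... | vP , vQ | inj₂ vB = x∈p∪q⁺ (inj₂ (x∈p∩q⁺ (x∈p∪q⁺ (inj₂ vP) , x∈p∩q⁺ (vB , vQ))))
    L∩R⊆ : L ∩ R ⊆ U ∩ W
    L∩R⊆ v∈ with x∈p∩q⁻ L R v∈
    ... | v∈L , v∈R with x∈p∩q⁻ (A ∩ P) (B ∪ Q) v∈L | x∈p∩q⁻ (A ∪ P) (B ∩ Q) v∈R
    ...   | v∈AP , _ | _ , v∈BQ with x∈p∩q⁻ A P v∈AP | x∈p∩q⁻ B Q v∈BQ
    ...     | vA , vP | vB , vQ = x∈p∩q⁺ (x∈p∩q⁺ (vA , vB) , x∈p∩q⁺ (vP , vQ))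
    U∩W⊆ : U ∩ W ⊆ L ∩ R
    U∩W⊆ v∈ with x∈p∩q⁻ U W v∈
    ... | v∈U , v∈W with x∈p∩q⁻ A B v∈U | x∈p∩q⁻ P Q v∈W
    ...   | vA , vB | vP , vQ = x∈p∩q⁺
      ( x∈p∩q⁺ (x∈p∩q⁺ (vA , vP) , x∈p∪q⁺ (inj₁ vB))
      , x∈p∩q⁺ (x∈p∪q⁺ (inj₁ vA) , x∈p∩q⁺ (vB , vQ)) )

+≡⇒≤ˡ : ∀ {l r u w} → l + r ≡ u + w → w ≤ r → l ≤ u
+≡⇒≤ˡ {l} {r} {u} {w} eq w≤r = +-cancelʳ-≤ w l u (≤-trans (+-monoʳ-≤ l w≤r) (≤-reflexive eq))

+≡⇒≤ʳ : ∀ {l r u w} → l + r ≡ u + w → u ≤ l → r ≤ w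
+≡⇒≤ʳ {l} {r} {u} {w} eq u≤l = +-cancelˡ-≤ u r w (≤-trans (+-monoˡ-≤ r u≤l) (≤-reflexive eq))

+≡⇒≤ : ∀ {l r u w} → l + r ≡ u + w → u ≤ l → u ≤ r → u ≤ w
+≡⇒≤ eq u≤l u≤r = ≤-trans u≤r (+≡⇒≤ʳ eq u≤l)

-- Distinguishing and detaching separations

module _ (k : ℕ) {n : ℕ} (G : Graph n) where

  -- Inseparability in terms of separations; `inseparable⇒oriented` and `oriented⇒inseparable`
  -- identify the two notions.
  Oriented : Subset n → Set
  Oriented X = k ≤ ∣ X ∣ ×
    (∀ s → IsSeparation G s → order s < k → X ⊆ proj₁ s ⊎ X ⊆ proj₂ s)

  oriented? : Decidable Oriented
  oriented? X = k ≤? ∣ X ∣ ×-dec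
    all-pairs? λ s → isSeparation? G s →-dec order s <? k →-dec (X ⊆? proj₁ s ⊎-dec X ⊆? proj₂ s)

  -- Orientedness of `X` and `Y` is part of the family, which is therefore empty for unsuitable
  -- sets. So the chosen separations can range over all `X` and `Y`.
  record Distinguishes (X Y : Subset n) (s : Pair n) : Set where
    field
      orientedˡ : Oriented X
      orientedʳ : Oriented Y
      split     : Split G X Y s
      order<k   : order s < k
      minimal   : ∀ u → Split G X Y u → order s ≤ order u

    separation = proj₁ split
    left⊆  = proj₁ (proj₂ split)
    right⊆ = proj₂ (proj₂ split)

  distinguishes? : ∀ X Y → Decidable (Distinguishes X Y)
  distinguishes? X Y s = map′
    (λ (oX , oY , sp , o , m) → record
      { orientedˡ = oX ; orientedʳ = oY ; split = sp ; order<k = o ; minimal = m })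
    (λ E → let open Distinguishes E in orientedˡ , orientedʳ , split , order<k , minimal)
    (oriented? X ×-dec oriented? Y ×-dec split? G X Y s ×-dec order s <? k ×-dec
     all-pairs? λ u → split? G X Y u →-dec order s ≤? order u)

  -- The intended case: C is a component of G - X and Z is its neighbourhood.
  record Detaches (X C Z : Subset n) (s : Pair n) : Set where
    field
      oriented   : Oriented X
      uncut      : Uncut G C
      nonempty   : Nonempty C
      Z⊆X        : Z ⊆ X
      ∣Z∣<k      : ∣ Z ∣ < k
      neighbour  : ∀ z → z ∈ Z → ∃[ u ] u ∈ C × Adj G u z
      separation : IsSeparation G s
      C⊆         : C ⊆ proj₁ s
      C∩         : C ∩ proj₂ s ⊆ ⊥
      X⊆         : X ⊆ proj₂ s
      separator⊆ : proj₁ s ∩ proj₂ s ⊆ Z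

    order<k : order s < k
    order<k = ≤-<-trans (p⊆q⇒∣p∣≤∣q∣ separator⊆) ∣Z∣<k

    separator∈Z : ∀ {v} → v ∈ proj₁ s → v ∈ proj₂ s → v ∈ Z
    separator∈Z v∈A v∈B = separator⊆ (x∈p∩q⁺ (v∈A , v∈B))

    separator∈X : ∀ {v} → v ∈ proj₁ s → v ∈ proj₂ s → v ∈ X
    separator∈X v∈A v∈B = Z⊆X (separator∈Z v∈A v∈B)

    C∉ : ∀ {v} → v ∈ C → v ∉ proj₂ s
    C∉ v∈C v∈B = ∉⊥ (C∩ (x∈p∩q⁺ (v∈C , v∈B)))

    -- A connected set that misses the separator of `t` lies strictly on one side of `t`.
    C-side : ∀ {t} → IsSeparation G t → (∀ {v} → v ∈ C → v ∈ proj₁ t → v ∉ proj₂ t) →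
             (C ⊆ proj₁ t × (∀ {v} → v ∈ C → v ∉ proj₂ t)) ⊎
             (C ⊆ proj₂ t × (∀ {v} → v ∈ C → v ∉ proj₁ t))
    C-side {t} sep avoids
      with uncut t sep (λ v∈ → let v∈C , v∈S = x∈p∩q⁻ C _ v∈
                                   v∈P , v∈Q = x∈p∩q⁻ _ _ v∈S in
                               contradiction v∈Q (avoids v∈C v∈P))
    ... | inj₁ C⊆P = inj₁ (C⊆P , λ v∈C → avoids v∈C (C⊆P v∈C))
    ... | inj₂ C⊆Q = inj₂ (C⊆Q , λ v∈C v∈P → avoids v∈C v∈P (C⊆Q v∈C))

    -- Each `z` in `Z` has a neighbour in `C`; the edge between them must lie in the second side of
    -- `t`, since its end in `C` is not in the first.
    Z⊆if-C-avoids : ∀ {t} → IsSeparation G t → (∀ {v} → v ∈ C → v ∉ proj₁ t) → Z ⊆ proj₂ t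
    Z⊆if-C-avoids sep avoids {z} z∈Z with neighbour z z∈Z
    ... | u , u∈C , adj with together sep u z (inj₂ adj)
    ...   | inj₁ (u∈P , _) = contradiction u∈P (avoids u∈C)
    ...   | inj₂ (_ , z∈Q) = z∈Q

    move : ∀ {u} → IsSeparation G u → C ⊆ proj₁ u → (∀ {v} → v ∈ C → v ∉ proj₂ u) → X ⊆ proj₂ u →
           (∀ {v} → v ∈ proj₁ u → v ∈ proj₂ u → v ∈ Z) → Detaches X C Z u
    move sep C⊆u C∉u X⊆u ∈Z = record
      { oriented = oriented ; uncut = uncut ; nonempty = nonempty ; Z⊆X = Z⊆X ; ∣Z∣<k = ∣Z∣<k
      ; neighbour = neighbour ; separation = sep ; C⊆ = C⊆u
      ; C∩ = λ v∈ → let v∈C , v∈u = x∈p∩q⁻ C _ v∈ in contradiction v∈u (C∉u v∈C)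
      ; X⊆ = X⊆u
      ; separator⊆ = λ v∈ → let v∈₁ , v∈₂ = x∈p∩q⁻ _ _ v∈ in ∈Z v∈₁ v∈₂ }

    -- A vertex of the new separator lies in `proj₁ s`, and in `proj₂ s` or in the separator of `t`.
    -- The last hypothesis places it in `proj₂ s` in either case, hence in `Z`.
    move-∧ : ∀ {t} → IsSeparation G t → C ⊆ proj₁ t → (∀ {v} → v ∈ C → v ∉ proj₂ t) →
             (∀ {v} → v ∈ proj₁ t → v ∈ proj₂ t → v ∈ proj₂ s) → Detaches X C Z (s ∧ˢ t)
    move-∧ {t} sep C⊆P C∉Q ∈B = move (separation-∧ separation sep)
      (λ v∈C → x∈p∩q⁺ (C⊆ v∈C , C⊆P v∈C))
      (λ v∈C v∈BQ → Sum.[ C∉ v∈C , C∉Q v∈C ] (x∈p∪q⁻ _ _ v∈BQ))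
      (λ v∈X → x∈p∪q⁺ (inj₁ (X⊆ v∈X)))
      λ v∈AP v∈BQ → let v∈A , v∈P = x∈p∩q⁻ _ _ v∈AP in
        separator∈Z v∈A (Sum.[ (λ v∈B → v∈B) , ∈B v∈P ] (x∈p∪q⁻ _ _ v∈BQ))

    -- Dually, the last hypothesis places every vertex of the new separator in `proj₁ s`, hence in
    -- the separator of `s`. The set `C` needs no condition relative to `t`, because the first side
    -- only grows.
    move-∨ : ∀ {t} → IsSeparation G t → X ⊆ proj₂ t →
             (∀ {v} → v ∈ proj₁ t → v ∈ proj₂ t → v ∈ proj₁ s) → Detaches X C Z (s ∨ˢ t)
    move-∨ {t} sep X⊆Q ∈A = move (separation-∨ separation sep)
      (λ v∈C → x∈p∪q⁺ (inj₁ (C⊆ v∈C)))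
      (λ v∈C v∈BQ → C∉ v∈C (p∩q⊆p _ _ v∈BQ))
      (λ v∈X → x∈p∩q⁺ (X⊆ v∈X , X⊆Q v∈X))
      λ v∈AP v∈BQ → let v∈B , v∈Q = x∈p∩q⁻ _ _ v∈BQ in
        separator∈Z (Sum.[ (λ v∈A → v∈A) , (λ v∈P → ∈A v∈P v∈Q) ] (x∈p∪q⁻ _ _ v∈AP)) v∈B

  detaches? : ∀ X C Z → Decidable (Detaches X C Z)
  detaches? X C Z s = map′ {A = _ × _ × _ × Z ⊆ X × _ × _ × _ × C ⊆ proj₁ s × C ∩ proj₂ s ⊆ ⊥ × X ⊆ proj₂ s × proj₁ s ∩ proj₂ s ⊆ Z}
    (λ (o , uc , ne , zx , zk , nb , sp , c₁ , c₂ , x₂ , z₂) → record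
      { oriented = o ; uncut = uc ; nonempty = ne ; Z⊆X = zx ; ∣Z∣<k = zk ; neighbour = nb
      ; separation = sp ; C⊆ = c₁ ; C∩ = c₂ ; X⊆ = x₂ ; separator⊆ = z₂ })
    (λ D → let open Detaches D in
      oriented , uncut , nonempty , Z⊆X , ∣Z∣<k , neighbour ,
      separation , C⊆ , C∩ , X⊆ , separator⊆)
    (oriented? X ×-dec uncut? G C ×-dec nonempty? C ×-dec Z ⊆? X ×-dec ∣ Z ∣ <? k ×-dec
     (Fin.all? λ z → z ∈? Z →-dec Fin.any? λ u → u ∈? C ×-dec Graph.adj? G u z) ×-dec
     isSeparation? G s ×-dec C ⊆? proj₁ s ×-dec C ∩ proj₂ s ⊆? ⊥ ×-dec X ⊆? proj₂ s ×-dec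
     proj₁ s ∩ proj₂ s ⊆? Z)

  distinguishes-⋆ : ∀ {X Y s} → Distinguishes X Y s → Distinguishes Y X (s ⋆)
  distinguishes-⋆ {s = s} E = record
    { orientedˡ = orientedʳ
    ; orientedʳ = orientedˡ
    ; split     = separation-⋆ separation , right⊆ , left⊆
    ; order<k   = subst (_< k) (sym (order-⋆ s)) order<k
    ; minimal   = λ u (sep , Y⊆ , X⊆) → subst₂ _≤_ (sym (order-⋆ s)) (order-⋆ u)
                    (minimal (u ⋆) (separation-⋆ sep , X⊆ , Y⊆))
    }
    where open Distinguishes E

  distinguishes-≤ : ∀ {X Y s u} → Distinguishes X Y s → Split G X Y u → order u ≤ order s →
                    Distinguishes X Y u
  distinguishes-≤ E split-u le = record
    { orientedˡ = orientedˡ ; orientedʳ = orientedʳ ; split = split-u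
    ; order<k = ≤-<-trans le order<k ; minimal = λ v split-v → ≤-trans le (minimal v split-v) }
    where open Distinguishes E

  -- The order of `s` is minimal, so an inclusion of the separators must be an equality. This
  -- replaces counting when the other separation is a detaching one, whose separator is bounded by
  -- the set `Z` and not by minimality of order.
  distinguishes-⊆ : ∀ {X Y s u} → Distinguishes X Y s → Split G X Y u →
                    proj₁ u ∩ proj₂ u ⊆ proj₁ s ∩ proj₂ s →
                    Distinguishes X Y u × proj₁ s ∩ proj₂ s ⊆ proj₁ u ∩ proj₂ u
  distinguishes-⊆ {u = u} E split-u sub =
    distinguishes-≤ E split-u (p⊆q⇒∣p∣≤∣q∣ sub) ,
    p⊆q∧∣q∣≤∣p∣⇒q⊆p sub (Distinguishes.minimal E u split-u)

  LeastDistinguishing : Subset n → Subset n → Pair n → Set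
  LeastDistinguishing X Y = Least (Distinguishes X Y)

  LeastDetaching : Subset n → Subset n → Subset n → Pair n → Set
  LeastDetaching X C Z = Least (Detaches X C Z)

  leastDistinguishing-⋆ : ∀ {X Y s} → LeastDistinguishing X Y s → LeastDistinguishing Y X (s ⋆)
  leastDistinguishing-⋆ = least-⋆ distinguishes-⋆ distinguishes-⋆

  -- Nestedness of the members with fewest crossings

  module _ {X Y X′ Y′ s t} (L : LeastDistinguishing X Y s) (L′ : LeastDistinguishing X′ Y′ t) where
    private
      module E  = Distinguishes (Least.member L)
      module E′ = Distinguishes (Least.member L′)

    -- The meet still splits `X` from `Y` and the join splits `X′` from `Y′`. Neither has order
    -- below the minimum for its pair, and the orders have the same sum as those of `s` and `t`, so
    -- both attain their minimum.
    distinguishing-opposite : X ⊆ proj₁ t → Y′ ⊆ proj₂ s → Nested s t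
    distinguishing-opposite X⊆P Y′⊆B = nested-if-corners L L′
      (distinguishes-≤ (Least.member L) split∧
        (+≡⇒≤ˡ (order-corners E.separation E′.separation) (E′.minimal _ split∨)))
      (distinguishes-≤ (Least.member L′) split∨
        (+≡⇒≤ʳ (order-corners E.separation E′.separation) (E.minimal _ split∧)))
      where
      split∧ : Split G X Y (s ∧ˢ t)
      split∧ = separation-∧ E.separation E′.separation ,
               (λ x∈ → x∈p∩q⁺ (E.left⊆ x∈ , X⊆P x∈)) ,
               (λ y∈ → x∈p∪q⁺ (inj₁ (E.right⊆ y∈)))
      split∨ : Split G X′ Y′ (s ∨ˢ t)
      split∨ = separation-∨ E.separation E′.separation ,
               (λ x∈ → x∈p∪q⁺ (inj₂ (E′.left⊆ x∈))) ,
               (λ y∈ → x∈p∩q⁺ (Y′⊆B y∈ , E′.right⊆ y∈))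

    -- Both separations split both pairs, so `s` and `t` have equal order and all four corners have
    -- this order too. One pair of opposite corners then belongs to the family of `s` and the other
    -- to that of `t ⋆`.
    distinguishing-all-corners : X ⊆ proj₁ t → Y ⊆ proj₂ t → X′ ⊆ proj₂ s → Y′ ⊆ proj₁ s → Nested s t
    distinguishing-all-corners X⊆P Y⊆Q X′⊆B Y′⊆A = nested-if-all-corners {t = t} L (leastDistinguishing-⋆ L′)
      (distinguishes-≤ (Least.member L) split∧
        (+≡⇒≤ˡ eq (≤-trans t≤s (E.minimal _ split∨))))
      (distinguishes-≤ (Least.member L) split∨
        (≤-trans (+≡⇒≤ʳ eq (E.minimal _ split∧)) t≤s))
      (distinguishes-≤ member′ split∧′
        (≤-trans (+≡⇒≤ˡ eq′ (minimal′ _ split∨′)) s≤t⋆))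
      (distinguishes-≤ member′ split∨′
        (+≡⇒≤ʳ eq′ (≤-trans s≤t⋆ (minimal′ _ split∧′))))
      where
      member′ = Least.member (leastDistinguishing-⋆ L′)
      open Distinguishes member′ using () renaming (minimal to minimal′; separation to separation′)
      eq = order-corners E.separation E′.separation
      eq′ = order-corners E.separation separation′
      split∧ : Split G X Y (s ∧ˢ t)
      split∧ = separation-∧ E.separation E′.separation ,
               (λ x∈ → x∈p∩q⁺ (E.left⊆ x∈ , X⊆P x∈)) ,
               (λ y∈ → x∈p∪q⁺ (inj₁ (E.right⊆ y∈)))
      split∨ : Split G X Y (s ∨ˢ t)
      split∨ = separation-∨ E.separation E′.separation ,
               (λ x∈ → x∈p∪q⁺ (inj₁ (E.left⊆ x∈))) ,
               (λ y∈ → x∈p∩q⁺ (E.right⊆ y∈ , Y⊆Q y∈))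
      split∧′ : Split G Y′ X′ (s ∧ˢ t ⋆)
      split∧′ = separation-∧ E.separation separation′ ,
               (λ y∈ → x∈p∩q⁺ (Y′⊆A y∈ , E′.right⊆ y∈)) ,
               (λ x∈ → x∈p∪q⁺ (inj₂ (E′.left⊆ x∈)))
      split∨′ : Split G Y′ X′ (s ∨ˢ t ⋆)
      split∨′ = separation-∨ E.separation separation′ ,
               (λ y∈ → x∈p∪q⁺ (inj₂ (E′.right⊆ y∈))) ,
               (λ x∈ → x∈p∩q⁺ (X′⊆B x∈ , E′.left⊆ x∈))
      -- The meet and the join of `s` and `t` both split `X` from `Y`, so each has order at least
      -- that of `s`; the sum of the orders leaves at least as much for `t`.
      s≤t⋆ : order s ≤ order (t ⋆)
      s≤t⋆ = ≤-trans (+≡⇒≤ eq (E.minimal _ split∧) (E.minimal _ split∨)) (≤-reflexive (sym (order-⋆ t)))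
      t≤s : order t ≤ order s
      t≤s = ≤-trans (≤-reflexive (sym (order-⋆ t)))
        (+≡⇒≤ (trans eq′ (+-comm (order s) _)) (minimal′ _ split∧′) (minimal′ _ split∨′))

module _ (k : ℕ) {n : ℕ} (G : Graph n) where

  -- Each of the four sets lies in one of the four corners. If one of `X`, `Y` is in the corner
  -- opposite to one of `X′`, `Y′`, the case of opposite corners applies after inversions. Otherwise
  -- `X` and `Y` occupy two opposite corners and `X′` and `Y′` the other two.
  distinguishing-nested : ∀ {X Y X′ Y′ s t} →
    LeastDistinguishing k G X Y s → LeastDistinguishing k G X′ Y′ t → Nested s t
  distinguishing-nested {X} {Y} {X′} {Y′} {s} {t} L L′ =
    go (side E.orientedˡ t∈) (side E.orientedʳ t∈) (side E′.orientedˡ s∈) (side E′.orientedʳ s∈)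
    where
    module E  = Distinguishes (Least.member L)
    module E′ = Distinguishes (Least.member L′)
    L⋆ = leastDistinguishing-⋆ k G L
    L′⋆ = leastDistinguishing-⋆ k G L′
    s∈ = E.separation , E.order<k
    t∈ = E′.separation , E′.order<k
    side : ∀ {Z u} → Oriented k G Z → IsSeparation G u × order u < k → Z ⊆ proj₁ u ⊎ Z ⊆ proj₂ u
    side (_ , orient) (sep , small) = orient _ sep small
    go : X ⊆ proj₁ t ⊎ X ⊆ proj₂ t → Y ⊆ proj₁ t ⊎ Y ⊆ proj₂ t →
         X′ ⊆ proj₁ s ⊎ X′ ⊆ proj₂ s → Y′ ⊆ proj₁ s ⊎ Y′ ⊆ proj₂ s → Nested s t
    go (inj₁ X⊆P) _          _           (inj₂ Y′⊆B) = distinguishing-opposite k G L L′ X⊆P Y′⊆B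
    go (inj₁ X⊆P) (inj₁ Y⊆P) _           (inj₁ Y′⊆A) =
      nested-⋆ˡ (distinguishing-opposite k G L⋆ L′ Y⊆P Y′⊆A)
    go (inj₁ X⊆P) (inj₂ Y⊆Q) (inj₁ X′⊆A) (inj₁ Y′⊆A) =
      nested-⋆ˡ (nested-⋆ʳ (distinguishing-opposite k G L⋆ L′⋆ Y⊆Q X′⊆A))
    go (inj₁ X⊆P) (inj₂ Y⊆Q) (inj₂ X′⊆B) (inj₁ Y′⊆A) =
      distinguishing-all-corners k G L L′ X⊆P Y⊆Q X′⊆B Y′⊆A
    go (inj₂ X⊆Q) _          (inj₂ X′⊆B) _           =
      nested-⋆ʳ (distinguishing-opposite k G L L′⋆ X⊆Q X′⊆B)
    go (inj₂ X⊆Q) (inj₂ Y⊆Q) (inj₁ X′⊆A) _           =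
      nested-⋆ˡ (nested-⋆ʳ (distinguishing-opposite k G L⋆ L′⋆ Y⊆Q X′⊆A))
    go (inj₂ X⊆Q) (inj₁ Y⊆P) (inj₁ X′⊆A) (inj₁ Y′⊆A) =
      nested-⋆ˡ (distinguishing-opposite k G L⋆ L′ Y⊆P Y′⊆A)
    go (inj₂ X⊆Q) (inj₁ Y⊆P) (inj₁ X′⊆A) (inj₂ Y′⊆B) =
      nested-⋆ʳ (distinguishing-all-corners k G L L′⋆ X⊆Q Y⊆P Y′⊆B X′⊆A)

  module _ {X C Z s} (L : LeastDetaching k G X C Z s) where
    private module D = Detaches (Least.member L)

    -- The separator of `s` lies in `X`, hence in `P`. The cases follow the side of `s` containing
    -- `Y′`, then the side of `t` containing `C`, then the side of `s` containing `Y`.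
    detaching-distinguishing-nested′ : ∀ {Y Y′ t} →
      LeastDistinguishing k G Y Y′ t → X ⊆ proj₁ t → Nested s t
    detaching-distinguishing-nested′ {Y} {Y′} {t} L′ X⊆P =
      go (orient E.orientedˡ) (orient E.orientedʳ)
      where
      module E = Distinguishes (Least.member L′)
      L′⋆ = leastDistinguishing-⋆ k G L′
      sep∧ = separation-∧ D.separation E.separation
      sep∨ = separation-∨ D.separation E.separation
      sep∧⋆ = separation-∧ D.separation (separation-⋆ E.separation)
      sep∨⋆ = separation-∨ D.separation (separation-⋆ E.separation)
      A B P Q : Subset n
      A = proj₁ s
      B = proj₂ s
      P = proj₁ t
      Q = proj₂ t

      orient : ∀ {V} → Oriented k G V → V ⊆ A ⊎ V ⊆ B
      orient (_ , o) = o s D.separation D.order<k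

      AB⊆P : ∀ {v} → v ∈ A → v ∈ B → v ∈ P
      AB⊆P v∈A v∈B = X⊆P (D.separator∈X v∈A v∈B)

      Y⊆ : {V : Subset n} → Y ⊆ P ∪ V
      Y⊆ y∈ = x∈p∪q⁺ (inj₁ (E.left⊆ y∈))

      Y′-left : Y′ ⊆ A → Nested s t
      Y′-left Y′⊆A = nested-⋆ʳ (nested-if-corners′ L L′⋆ (proj₁ E∧)
        (D.move-∨ (separation-⋆ E.separation) X⊆P λ v∈Q v∈P →
          p∩q⊆p A Q (p∩q⊆p (A ∩ Q) (B ∪ P) (proj₂ E∧ (x∈p∩q⁺ (v∈Q , v∈P))))))
        where
        -- The separator of this corner lies in that of `t` because `A ∩ B` lies in `P`. They are
        -- therefore equal, which puts `P ∩ Q` inside `A` and keeps the join in the detaching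
        -- family.
        E∧ = distinguishes-⊆ k G {u = s ∧ˢ t ⋆} (Least.member L′⋆)
          (sep∧⋆ , (λ y∈ → x∈p∩q⁺ (Y′⊆A y∈ , E.right⊆ y∈)) , λ y∈ → x∈p∪q⁺ (inj₂ (E.left⊆ y∈)))
          λ v∈ → let v∈AQ , v∈BP = x∈p∩q⁻ (A ∩ Q) (B ∪ P) v∈
                     v∈A , v∈Q = x∈p∩q⁻ A Q v∈AQ in
            x∈p∩q⁺ (v∈Q , Sum.[ AB⊆P v∈A , (λ v∈P → v∈P) ] (x∈p∪q⁻ B P v∈BP))

      Y′-right : Y ⊆ A ⊎ Y ⊆ B → Y′ ⊆ B → Nested s t
      Y′-right Y-side Y′⊆B = C-cases
        (D.C-side E.separation λ v∈C v∈P v∈Q → D.C∉ v∈C (PQ⊆B v∈P v∈Q))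
        where
        -- As before, equality of the separators puts `P ∩ Q` inside `B`. Since `C` misses `B`, it
        -- misses the separator of `t` and picks a strict side.
        E∨ = distinguishes-⊆ k G {u = s ∨ˢ t} (Least.member L′)
          (sep∨ , (λ y∈ → x∈p∪q⁺ (inj₂ (E.left⊆ y∈))) , λ y∈ → x∈p∩q⁺ (Y′⊆B y∈ , E.right⊆ y∈))
          λ v∈ → let v∈AP , v∈BQ = x∈p∩q⁻ (A ∪ P) (B ∩ Q) v∈
                     v∈B , v∈Q = x∈p∩q⁻ B Q v∈BQ in
            x∈p∩q⁺ (Sum.[ (λ v∈A → AB⊆P v∈A v∈B) , (λ v∈P → v∈P) ] (x∈p∪q⁻ A P v∈AP) , v∈Q)

        PQ⊆B : ∀ {v} → v ∈ P → v ∈ Q → v ∈ B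
        PQ⊆B v∈P v∈Q = p∩q⊆p B Q (p∩q⊆q (A ∪ P) (B ∩ Q) (proj₂ E∨ (x∈p∩q⁺ (v∈P , v∈Q))))

        C-cases : (C ⊆ P × (∀ {v} → v ∈ C → v ∉ Q)) ⊎ (C ⊆ Q × (∀ {v} → v ∈ C → v ∉ P)) → Nested s t
        C-cases (inj₁ (C⊆P , C∉Q)) = nested-if-corners L L′ (D.move-∧ E.separation C⊆P C∉Q PQ⊆B) (proj₁ E∨)
        C-cases (inj₂ (C⊆Q , C∉P)) = nested-⋆ʳ (Y-cases Y-side)
          where
          Z⊆Q : Z ⊆ Q
          Z⊆Q = D.Z⊆if-C-avoids E.separation C∉P

          D∧ : Detaches k G X C Z (s ∧ˢ t ⋆)
          D∧ = D.move-∧ (separation-⋆ E.separation) C⊆Q C∉P λ v∈Q v∈P → PQ⊆B v∈P v∈Q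

          Y-cases : Y ⊆ A ⊎ Y ⊆ B → Nested s (t ⋆)
          Y-cases (inj₂ Y⊆B) = nested-if-corners L L′⋆ D∧ (proj₁ (distinguishes-⊆ k G (Least.member L′⋆)
            (sep∨⋆ , (λ y∈ → x∈p∪q⁺ (inj₂ (E.right⊆ y∈))) , λ y∈ → x∈p∩q⁺ (Y⊆B y∈ , E.left⊆ y∈))
            λ v∈ → let v∈AQ , v∈BP = x∈p∩q⁻ (A ∪ Q) (B ∩ P) v∈
                       v∈B , v∈P = x∈p∩q⁻ B P v∈BP in
              x∈p∩q⁺ (Sum.[ (λ v∈A → Z⊆Q (D.separator∈Z v∈A v∈B)) , (λ v∈Q → v∈Q) ]
                        (x∈p∪q⁻ A Q v∈AQ) , v∈P)))
          -- Now `C` is strictly in `Q` and `Y` is in `A`: the corners with `t ⋆` both detach `C`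
          -- from `X`, and the corners with `t` both distinguish `Y` from `Y′`.
          Y-cases (inj₁ Y⊆A) = nested-if-all-corners {t = t ⋆} L L′ D∧
            (D.move-∨ (separation-⋆ E.separation) X⊆P λ v∈Q v∈P →
              p∩q⊆p A P (p∩q⊆p (A ∩ P) (B ∪ Q) (proj₂ E∧ (x∈p∩q⁺ (v∈P , v∈Q)))))
            (proj₁ E∧) (proj₁ E∨)
            where
            E∧ = distinguishes-⊆ k G {u = s ∧ˢ t} (Least.member L′)
              (sep∧ , (λ y∈ → x∈p∩q⁺ (Y⊆A y∈ , E.left⊆ y∈)) , λ y∈ → x∈p∪q⁺ (inj₂ (E.right⊆ y∈)))
              λ v∈ → let v∈AP , v∈BQ = x∈p∩q⁻ (A ∩ P) (B ∪ Q) v∈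
                         v∈A , v∈P = x∈p∩q⁻ A P v∈AP in
                x∈p∩q⁺ (v∈P , Sum.[ (λ v∈B → Z⊆Q (D.separator∈Z v∈A v∈B)) , (λ v∈Q → v∈Q) ]
                                (x∈p∪q⁻ B Q v∈BQ))

      go : Y ⊆ A ⊎ Y ⊆ B → Y′ ⊆ A ⊎ Y′ ⊆ B → Nested s t
      go _      (inj₁ Y′⊆A) = Y′-left Y′⊆A
      go Y-side (inj₂ Y′⊆B) = Y′-right Y-side Y′⊆B

    detaching-distinguishing-nested : ∀ {Y Y′ t} → LeastDistinguishing k G Y Y′ t → Nested s t
    detaching-distinguishing-nested {t = t} L′
      with proj₂ D.oriented t (Distinguishes.separation (Least.member L′))
                              (Distinguishes.order<k (Least.member L′))
    ... | inj₁ X⊆P = detaching-distinguishing-nested′ L′ X⊆P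
    ... | inj₂ X⊆Q = nested-⋆ʳ (detaching-distinguishing-nested′ (leastDistinguishing-⋆ k G L′) X⊆Q)

  module _ {X C Z s Y C′ Z′ t} (L : LeastDetaching k G X C Z s) (L′ : LeastDetaching k G Y C′ Z′ t) where
    private
      module D  = Detaches (Least.member L)
      module D′ = Detaches (Least.member L′)
      A B P Q : Subset n
      A = proj₁ s
      B = proj₂ s
      P = proj₁ t
      Q = proj₂ t
      -- The family of inverses, for corners of `s` with `t ⋆` whose inverse detaches `C′` from `Y`.
      L′⋆ : Least (Detaches k G Y C′ Z′ ∘ _⋆) (t ⋆)
      L′⋆ = least-⋆ (λ d → d) (λ d → d) L′

      ∧-comm : Detaches k G Y C′ Z′ (t ∧ˢ s) → Detaches k G Y C′ Z′ (s ∧ˢ t)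
      ∧-comm = subst (Detaches k G Y C′ Z′) (∧ˢ-comm t s)
      ∨-comm : Detaches k G Y C′ Z′ (t ∨ˢ s) → Detaches k G Y C′ Z′ (s ∨ˢ t)
      ∨-comm = subst (Detaches k G Y C′ Z′) (∨ˢ-comm t s)
      ∧⋆-comm : Detaches k G Y C′ Z′ (t ∧ˢ s ⋆) → Detaches k G Y C′ Z′ ((s ∨ˢ t ⋆) ⋆)
      ∧⋆-comm = subst (Detaches k G Y C′ Z′) (∧ˢ-comm t (s ⋆))
      ∨⋆-comm : Detaches k G Y C′ Z′ (t ∨ˢ s ⋆) → Detaches k G Y C′ Z′ ((s ∧ˢ t ⋆) ⋆)
      ∨⋆-comm = subst (Detaches k G Y C′ Z′) (∨ˢ-comm t (s ⋆))

    -- The separator of `s` lies in `X`, hence in `P`, and that of `t` lies in `Y`, hence in `A`. So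
    -- the join with `t ⋆` detaches `C`, and the inverse of the opposite corner detaches `C′`.
    detaching-nested-towards : X ⊆ P → Y ⊆ A → Nested s t
    detaching-nested-towards X⊆P Y⊆A = nested-⋆ʳ (nested-if-corners′ L L′⋆
      (∨⋆-comm (D′.move-∨ (separation-⋆ D.separation) Y⊆A λ v∈B v∈A → X⊆P (D.separator∈X v∈A v∈B)))
      (D.move-∨ (separation-⋆ D′.separation) X⊆P λ v∈Q v∈P → Y⊆A (D′.separator∈X v∈P v∈Q)))

    -- Both `C` and `C′` pick strict sides of the other separation. If `C` is in `P` or `C′` in `A`,
    -- the meet and the join of `s` and `t` serve. If `C` is in `Q` and `C′` in `B`, then `s ∧ˢ t ⋆`
    -- and `t ∧ˢ s ⋆` do.
    detaching-nested-away : X ⊆ Q → Y ⊆ B → Nested s t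
    detaching-nested-away X⊆Q Y⊆B =
      go (D.C-side D′.separation λ v∈C v∈P v∈Q → D.C∉ v∈C (PQ⊆B v∈P v∈Q))
         (D′.C-side D.separation λ v∈C′ v∈A v∈B → D′.C∉ v∈C′ (AB⊆Q v∈A v∈B))
      where
      PQ⊆B : ∀ {v} → v ∈ P → v ∈ Q → v ∈ B
      PQ⊆B v∈P v∈Q = Y⊆B (D′.separator∈X v∈P v∈Q)
      AB⊆Q : ∀ {v} → v ∈ A → v ∈ B → v ∈ Q
      AB⊆Q v∈A v∈B = X⊆Q (D.separator∈X v∈A v∈B)
      go : (C ⊆ P × (∀ {v} → v ∈ C → v ∉ Q)) ⊎ (C ⊆ Q × (∀ {v} → v ∈ C → v ∉ P)) →
           (C′ ⊆ A × (∀ {v} → v ∈ C′ → v ∉ B)) ⊎ (C′ ⊆ B × (∀ {v} → v ∈ C′ → v ∉ A)) → Nested s t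
      go (inj₁ (C⊆P , C∉Q)) _ = nested-if-corners L L′
        (D.move-∧ D′.separation C⊆P C∉Q PQ⊆B)
        (∨-comm (D′.move-∨ D.separation Y⊆B λ v∈A v∈B →
          D.Z⊆if-C-avoids (separation-⋆ D′.separation) C∉Q (D.separator∈Z v∈A v∈B)))
      go (inj₂ _) (inj₁ (C′⊆A , C′∉B)) = nested-if-corners′ L L′
        (∧-comm (D′.move-∧ D.separation C′⊆A C′∉B AB⊆Q))
        (D.move-∨ D′.separation X⊆Q λ v∈P v∈Q →
          D′.Z⊆if-C-avoids (separation-⋆ D.separation) C′∉B (D′.separator∈Z v∈P v∈Q))
      go (inj₂ (C⊆Q , C∉P)) (inj₂ (C′⊆B , C′∉A)) = nested-⋆ʳ (nested-if-corners L L′⋆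
        (D.move-∧ (separation-⋆ D′.separation) C⊆Q C∉P λ v∈Q v∈P → PQ⊆B v∈P v∈Q)
        (∧⋆-comm (D′.move-∧ (separation-⋆ D.separation) C′⊆B C′∉A λ v∈B v∈A → AB⊆Q v∈A v∈B)))

    -- The join of `s` and `t` always detaches `C′`, and the meet detaches `C` if `C` is in `P`. If
    -- `C` is in `Q`, then `s ∧ˢ t ⋆` detaches `C`, and the opposite corner serves when `C′` is in
    -- `B`. When `C′` is in `A`, both corners with `t ⋆` detach `C` and both corners with `t` detach
    -- `C′`.
    detaching-nested-parallel : X ⊆ P → Y ⊆ B → Nested s t
    detaching-nested-parallel X⊆P Y⊆B =
      go (D.C-side D′.separation λ v∈C v∈P v∈Q → D.C∉ v∈C (PQ⊆B v∈P v∈Q))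
      where
      PQ⊆B : ∀ {v} → v ∈ P → v ∈ Q → v ∈ B
      PQ⊆B v∈P v∈Q = Y⊆B (D′.separator∈X v∈P v∈Q)
      AB⊆P : ∀ {v} → v ∈ A → v ∈ B → v ∈ P
      AB⊆P v∈A v∈B = X⊆P (D.separator∈X v∈A v∈B)
      D′∨ : Detaches k G Y C′ Z′ (s ∨ˢ t)
      D′∨ = ∨-comm (D′.move-∨ D.separation Y⊆B AB⊆P)
      go : (C ⊆ P × (∀ {v} → v ∈ C → v ∉ Q)) ⊎ (C ⊆ Q × (∀ {v} → v ∈ C → v ∉ P)) → Nested s t
      go (inj₁ (C⊆P , C∉Q)) = nested-if-corners L L′ (D.move-∧ D′.separation C⊆P C∉Q PQ⊆B) D′∨
      go (inj₂ (C⊆Q , C∉P)) = nested-⋆ʳ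
        (go′ (D′.C-side D.separation λ v∈C′ v∈A v∈B → D′.C∉ v∈C′ (AB⊆Q v∈A v∈B)))
        where
        AB⊆Q : ∀ {v} → v ∈ A → v ∈ B → v ∈ Q
        AB⊆Q v∈A v∈B = D.Z⊆if-C-avoids D′.separation C∉P (D.separator∈Z v∈A v∈B)
        D∧ : Detaches k G X C Z (s ∧ˢ t ⋆)
        D∧ = D.move-∧ (separation-⋆ D′.separation) C⊆Q C∉P λ v∈Q v∈P → PQ⊆B v∈P v∈Q
        go′ : (C′ ⊆ A × (∀ {v} → v ∈ C′ → v ∉ B)) ⊎ (C′ ⊆ B × (∀ {v} → v ∈ C′ → v ∉ A)) →
              Nested s (t ⋆)
        go′ (inj₂ (C′⊆B , C′∉A)) = nested-if-corners L L′⋆ D∧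
          (∧⋆-comm (D′.move-∧ (separation-⋆ D.separation) C′⊆B C′∉A λ v∈B v∈A → AB⊆Q v∈A v∈B))
        go′ (inj₁ (C′⊆A , C′∉B)) = nested-if-all-corners {t = t ⋆} L L′ D∧
          (D.move-∨ (separation-⋆ D′.separation) X⊆P λ v∈Q v∈P →
            D′.Z⊆if-C-avoids (separation-⋆ D.separation) C′∉B (D′.separator∈Z v∈P v∈Q))
          (∧-comm (D′.move-∧ D.separation C′⊆A C′∉B AB⊆Q))
          D′∨

  detaching-nested : ∀ {X C Z s Y C′ Z′ t} →
    LeastDetaching k G X C Z s → LeastDetaching k G Y C′ Z′ t → Nested s t
  detaching-nested {s = s} {t = t} L L′
    with proj₂ D.oriented t D′.separation D′.order<k | proj₂ D′.oriented s D.separation D.order<k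
    where
    module D  = Detaches (Least.member L)
    module D′ = Detaches (Least.member L′)
  ... | inj₁ X⊆P | inj₁ Y⊆A = detaching-nested-towards L L′ X⊆P Y⊆A
  ... | inj₁ X⊆P | inj₂ Y⊆B = detaching-nested-parallel L L′ X⊆P Y⊆B
  ... | inj₂ X⊆Q | inj₁ Y⊆A = nested-sym (detaching-nested-parallel L′ L Y⊆A X⊆Q)
  ... | inj₂ X⊆Q | inj₂ Y⊆B = detaching-nested-away L L′ X⊆Q Y⊆B

-- The tree of consistent orientations of a nested set of separations

lookup-injective : ∀ {A : Set} {xs : List A} → Unique xs → ∀ i j →
                   List.lookup xs i ≡ List.lookup xs j → i ≡ j
lookup-injective (_ ∷ _)  zero    zero    _  = refl
lookup-injective (x∉ ∷ _) zero    (suc j) eq = contradiction eq (All.lookup x∉ (∈-lookup j))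
lookup-injective (x∉ ∷ _) (suc i) zero    eq = contradiction (sym eq) (All.lookup x∉ (∈-lookup i))
lookup-injective (_ ∷ u)  (suc i) (suc j) eq = cong suc (lookup-injective u i j eq)

infix 4 _≟ˢ_

_≟ˢ_ : ∀ {n} (s t : Pair n) → Dec (s ≡ t)
_≟ˢ_ = Product.≡-dec (Vec.≡-dec Bool._≟_) (Vec.≡-dec Bool._≟_)

last∈ : ∀ {n} {G : Graph n} {u v} (p : Walk G u v) → v List.∈ vertices p
last∈ [ _ ]      = here refl
last∈ (step _ p) = there (last∈ p)

first∈ : ∀ {n} {G : Graph n} {u v} (p : Walk G u v) → u List.∈ vertices p
first∈ [ _ ]      = here refl
first∈ (step _ p) = here refl

abstract

  -- Numbering the pairs makes a set of pairs a `Subset`, which can be counted and searched for.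
  #pairs : ℕ → ℕ
  #pairs n = length (pairs n)

  ix : ∀ {n} → Pair n → Fin (#pairs n)
  ix s = index (∈-pairs s)

  pair : ∀ {n} → Fin (#pairs n) → Pair n
  pair = List.lookup (pairs _)

  pair-ix : ∀ {n} (s : Pair n) → pair (ix s) ≡ s
  pair-ix s = sym (lookup-index (∈-pairs s))

  ix-pair : ∀ {n} (i : Fin (#pairs n)) → ix (pair {n} i) ≡ i
  ix-pair {n} i = lookup-injective (pairs-unique n) (ix (pair {n} i)) i (pair-ix (pair {n} i))

-- An orientation containing (A , B) points towards B.
Orientation : ℕ → Set
Orientation n = Subset (#pairs n)

module _ {n : ℕ} where

  infix 4 _∋_ _∋?_

  _∋_ : Orientation n → Pair n → Set
  O ∋ s = ix s ∈ O

  _∋?_ : ∀ O s → Dec (O ∋ s)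
  O ∋? s = ix s ∈? O

  module _ {R : Pair n → Set} (R? : Decidable R) where

    private
      at? : Decidable (R ∘ pair)
      at? i = R? (pair i)

    orientation : Orientation n
    orientation = comprehension at?

    ∋⁺ : ∀ {s} → R s → orientation ∋ s
    ∋⁺ {s} Rs = ∈-comprehension⁺ at? (subst R (sym (pair-ix s)) Rs)

    ∋⁻ : ∀ {s} → orientation ∋ s → R s
    ∋⁻ {s} s∈ = subst R (pair-ix s) (∈-comprehension⁻ at? s∈)

  ∋-⊆ : {O P : Orientation n} → (∀ s → O ∋ s → P ∋ s) → O ⊆ P
  ∋-⊆ {O} {P} imp {i} i∈O = subst (_∈ P) (ix-pair {n} i)
    (imp (pair i) (subst (_∈ O) (sym (ix-pair {n} i)) i∈O))

  -- Compares the sides by size, so that ties occur only between a pair and its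
  -- inverse; these are broken by their positions in the list of all pairs.
  Preferred : Pair n → Set
  Preferred s = ∣ proj₁ s ∣ < ∣ proj₂ s ∣ ⊎
    (∣ proj₁ s ∣ ≡ ∣ proj₂ s ∣ × ix s Fin.< ix (s ⋆))

  preferred? : Decidable Preferred
  preferred? s = ∣ proj₁ s ∣ <? ∣ proj₂ s ∣ ⊎-dec
    (∣ proj₁ s ∣ ℕ.≟ ∣ proj₂ s ∣ ×-dec ix s Fin.<? ix (s ⋆))

  preferred-total : ∀ s → s ≢ s ⋆ → Preferred s ⊎ Preferred (s ⋆)
  preferred-total s s≢s⋆ with <-cmp ∣ proj₁ s ∣ ∣ proj₂ s ∣
  ... | tri< lt _ _ = inj₁ (inj₁ lt)
  ... | tri> _ _ gt = inj₂ (inj₁ gt)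
  ... | tri≈ _ eq _ with Fin.<-cmp (ix s) (ix (s ⋆))
  ...   | tri< lt _ _ = inj₁ (inj₂ (eq , lt))
  ...   | tri> _ _ gt = inj₂ (inj₂ (sym eq , gt))
  ...   | tri≈ _ ix≡ _ = contradiction
    (trans (sym (pair-ix s)) (trans (cong pair ix≡) (pair-ix (s ⋆)))) s≢s⋆

  preferred-asym : ∀ s → Preferred s → ¬ Preferred (s ⋆)
  preferred-asym s (inj₁ lt)       (inj₁ gt)       = <-asym lt gt
  preferred-asym s (inj₁ lt)       (inj₂ (eq , _)) = <⇒≢ lt (sym eq)
  preferred-asym s (inj₂ (eq , _)) (inj₁ gt)       = <⇒≢ gt (sym eq)
  preferred-asym s (inj₂ (_ , lt)) (inj₂ (_ , gt)) = Fin.<-asym lt gt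

  -- Going down shrinks the first side and enlarges the second. A tie at `r` below a preferred `s`
  -- forces all four sizes to agree, and then `r ≡ s`.
  preferred-down : ∀ {r s} → r ≼ s → Preferred s → Preferred r
  preferred-down {r = r} {s} (C⊆A , B⊆D) pref with <-cmp ∣ proj₁ r ∣ ∣ proj₂ r ∣
  ... | tri< lt _ _ = inj₁ lt
  ... | tri> _ _ gt = contradiction
    (≤-trans (p⊆q⇒∣p∣≤∣q∣ C⊆A) (≤-trans (side≤ pref) (p⊆q⇒∣p∣≤∣q∣ B⊆D))) (<⇒≱ gt)
    where
    side≤ : Preferred s → ∣ proj₁ s ∣ ≤ ∣ proj₂ s ∣
    side≤ (inj₁ lt)       = <⇒≤ lt
    side≤ (inj₂ (eq , _)) = ≤-reflexive eq
  ... | tri≈ _ eq _ = tie pref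
    where
    ∣C∣≤∣A∣ = p⊆q⇒∣p∣≤∣q∣ C⊆A
    ∣B∣≤∣D∣ = p⊆q⇒∣p∣≤∣q∣ B⊆D
    tie : Preferred s → Preferred r
    tie (inj₁ lt) = contradiction eq (<⇒≢ (≤-<-trans ∣C∣≤∣A∣ (<-≤-trans lt ∣B∣≤∣D∣)))
    tie (inj₂ (eq′ , lt)) = subst Preferred (sym r≡s) (inj₂ (eq′ , lt))
      where
      r≡s : r ≡ s
      r≡s = ≼-antisym {s = r} {s} (C⊆A , B⊆D)
        ( p⊆q∧∣q∣≤∣p∣⇒q⊆p C⊆A
            (≤-trans (≤-reflexive eq′) (≤-trans ∣B∣≤∣D∣ (≤-reflexive (sym eq))))
        , p⊆q∧∣q∣≤∣p∣⇒q⊆p B⊆D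
            (≤-trans (≤-reflexive (sym eq)) (≤-trans ∣C∣≤∣A∣ (≤-reflexive eq′))) )

  -- Strictly decreasing along `_≼_`, so least weight yields a maximal element.
  weight : Pair n → ℕ
  weight (A , B) = ∣ ∁ A ∣ + ∣ B ∣

  ≼-weight : ∀ {s t} → s ≼ t → weight s ≤ weight t → s ≡ t
  ≼-weight {A , B} {P , Q} (A⊆P , Q⊆B) le = cong₂ _,_
    (⊆-antisym A⊆P λ {v} v∈P → x∉∁p⇒x∈p λ v∈∁A → x∈∁p⇒x∉p (∁A⊆∁P v∈∁A) v∈P)
    (⊆-antisym B⊆Q Q⊆B)
    where
    ∁P⊆∁A : ∁ P ⊆ ∁ A
    ∁P⊆∁A = p⊆q⇒∁p⊇∁q A⊆P
    ∁A⊆∁P : ∁ A ⊆ ∁ P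
    ∁A⊆∁P = p⊆q∧∣q∣≤∣p∣⇒q⊆p ∁P⊆∁A
      (+-cancelʳ-≤ ∣ Q ∣ _ _ (≤-trans (+-monoʳ-≤ ∣ ∁ A ∣ (p⊆q⇒∣p∣≤∣q∣ Q⊆B)) le))
    B⊆Q : B ⊆ Q
    B⊆Q = p⊆q∧∣q∣≤∣p∣⇒q⊆p Q⊆B
      (+-cancelˡ-≤ ∣ ∁ P ∣ _ _ (≤-trans (+-monoˡ-≤ ∣ B ∣ (p⊆q⇒∣p∣≤∣q∣ ∁P⊆∁A)) le))

-- Since the set is closed under inversion, `proper` says that neither side of a member contains the
-- other.
record NestedSet {n : ℕ} (G : Graph n) : Set₁ where
  field
    N          : Pair n → Set
    N?         : Decidable N
    N-⋆        : ∀ {s} → N s → N (s ⋆)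
    nested     : ∀ {s t} → N s → N t → Nested s t
    proper     : ∀ {s} → N s → ¬ (proj₁ s ⊆ proj₂ s)
    separation : ∀ {s} → N s → IsSeparation G s

module Tree {n : ℕ} {G : Graph n} (𝒩 : NestedSet G) where
  open NestedSet 𝒩

  ≢⋆ : ∀ {s} → N s → s ≢ s ⋆
  ≢⋆ Ns eq = proper Ns (⊆-reflexive (cong proj₁ eq))

  record Consistent (O : Orientation n) : Set where
    field
      member : ∀ {s} → O ∋ s → N s
      total  : ∀ {s} → N s → O ∋ s ⊎ O ∋ s ⋆
      asym   : ∀ {s} → O ∋ s → ¬ O ∋ s ⋆
      down   : ∀ {r s} → N r → O ∋ s → r ≼ s → O ∋ r
  open Consistent

  consistent? : Decidable Consistent
  consistent? O = map′
    (λ (m , t , a , d) → record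
      { member = m _ ; total = t _ ; asym = a _ ; down = λ {r} {s} Nr Os r≼s → d r s Nr Os r≼s })
    (λ cO → (λ _ → member cO) , (λ _ → total cO) , (λ _ → asym cO) , λ _ _ → down cO)
    ( (all-pairs? λ s → O ∋? s →-dec N? s)
    ×-dec (all-pairs? λ s → N? s →-dec (O ∋? s ⊎-dec O ∋? s ⋆))
    ×-dec (all-pairs? λ s → O ∋? s →-dec ¬? (O ∋? s ⋆))
    ×-dec (all-pairs? λ r → all-pairs? λ s → N? r →-dec O ∋? s →-dec r ≼? s →-dec O ∋? r) )

  consistent-≡ : ∀ {O P} → Consistent O → Consistent P → (∀ s → O ∋ s → P ∋ s) → O ≡ P
  consistent-≡ {O} {P} cO cP O⊆P = ⊆-antisym (∋-⊆ O⊆P) (∋-⊆ P⊆O)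
    where
    P⊆O : ∀ s → P ∋ s → O ∋ s
    P⊆O s Ps with total cO (member cP Ps)
    ... | inj₁ Os  = Os
    ... | inj₂ Os⋆ = contradiction (O⊆P (s ⋆) Os⋆) (asym cP Ps)

  record Flip (s : Pair n) (O P : Orientation n) : Set where
    field
      before : O ∋ s
      after  : P ∋ s ⋆
      agree  : ∀ r → r ≢ s → O ∋ r → P ∋ r
  open Flip

  flip? : ∀ s O P → Dec (Flip s O P)
  flip? s O P = map′
    (λ (b , a , g) → record { before = b ; after = a ; agree = g })
    (λ f → before f , after f , agree f)
    (O ∋? s ×-dec P ∋? s ⋆ ×-dec all-pairs? λ r → ¬? (r ≟ˢ s) →-dec O ∋? r →-dec P ∋? r)

  module _ {s O P} (cO : Consistent O) (cP : Consistent P) (f : Flip s O P) where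

    flip-sym : Flip (s ⋆) P O
    flip-sym = record { before = after f ; after = before f ; agree = back }
      where
      back : ∀ r → r ≢ s ⋆ → P ∋ r → O ∋ r
      back r r≢s⋆ Pr with total cO (member cP Pr)
      ... | inj₁ Or  = Or
      ... | inj₂ Or⋆ = contradiction
        (agree f (r ⋆) (λ r⋆≡s → r≢s⋆ (cong _⋆ r⋆≡s)) Or⋆) (asym cP Pr)

    flip-label : ∀ {r} → O ∋ r → ¬ P ∋ r → s ≡ r
    flip-label {r} Or ¬Pr with r ≟ˢ s
    ... | yes r≡s = sym r≡s
    ... | no  r≢s = contradiction (agree f r r≢s Or) ¬Pr

  -- Nestedness relates each `r` in `O` to `s`. If `r` lies below `s` or `s ⋆`, down-closure of `P`
  -- or `P′` puts `r` into `P`. The remaining relations contradict consistency of `O` or `O′` unless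
  -- `r ≡ s`. Hence `s` labels at most one edge in its direction.
  flip-unique : ∀ {s O O′ P P′} → Consistent O → Consistent O′ → Consistent P → Consistent P′ →
                Flip s O O′ → Flip s P P′ → O ≡ P
  flip-unique {s} {O} {O′} {P} {P′} cO cO′ cP cP′ f g = consistent-≡ cO cP O⊆P
    where
    O⊆P : ∀ r → O ∋ r → P ∋ r
    O⊆P r Or with nested (member cO Or) (member cO (before f))
    ... | ≼⁺⁺ r≼s = down cP (member cO Or) (before g) r≼s
    ... | ≼⁻⁺ r⋆≼s = contradiction (down cO (N-⋆ (member cO Or)) (before f) r⋆≼s) (asym cO Or)
    ... | ≼⁺⁻ r≼s⋆ = agree (flip-sym cP cP′ g) r
      (λ r≡s⋆ → asym cO (before f) (subst (O ∋_) r≡s⋆ Or))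
      (down cP′ (member cO Or) (after g) r≼s⋆)
    ... | ≼⁻⁻ r⋆≼s⋆ with r ≟ˢ s
    ...   | yes refl = before g
    ...   | no  r≢s  = contradiction (down cO′ (N-⋆ (member cO Or)) (after f) r⋆≼s⋆)
                                     (asym cO′ (agree f r r≢s Or))

  module _ {O P : Orientation n} (cO : Consistent O) (cP : Consistent P) where

    module _ {s : Pair n} (Os : O ∋ s) (¬Ps : ¬ P ∋ s)
             (largest : ∀ {u} → O ∋ u → ¬ P ∋ u → s ≼ u → s ≡ u) where

      Flipped : Pair n → Set
      Flipped r = (O ∋ r × r ≢ s) ⊎ r ≡ s ⋆

      flipped? : Decidable Flipped
      flipped? r = (O ∋? r ×-dec ¬? (r ≟ˢ s)) ⊎-dec r ≟ˢ s ⋆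

      flipped : Orientation n
      flipped = orientation flipped?

      private
        Ns = member cO Os

      flipped-flip : Flip s O flipped
      flipped-flip = record
        { before = Os
        ; after  = ∋⁺ flipped? (inj₂ refl)
        ; agree  = λ r r≢s Or → ∋⁺ flipped? (inj₁ (Or , r≢s)) }

      -- Reversing a maximal element of a down-closed orientation leaves it down-closed.
      flipped-consistent : Consistent flipped
      flipped-consistent = record
        { member = λ r∈ → mem (∋⁻ flipped? r∈)
        ; total  = λ Nr → Sum.map (∋⁺ flipped?) (∋⁺ flipped?) (tot Nr)
        ; asym   = λ r∈ r⋆∈ → as (∋⁻ flipped? r∈) (∋⁻ flipped? r⋆∈)
        ; down   = λ Nr u∈ r≼u → ∋⁺ flipped? (dn Nr (∋⁻ flipped? u∈) r≼u) }
        where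
        mem : ∀ {r} → Flipped r → N r
        mem (inj₁ (Or , _)) = member cO Or
        mem (inj₂ refl)     = N-⋆ Ns
        tot : ∀ {r} → N r → Flipped r ⊎ Flipped (r ⋆)
        tot {r} Nr with r ≟ˢ s | r ≟ˢ s ⋆
        ... | _        | yes r≡s⋆ = inj₁ (inj₂ r≡s⋆)
        ... | yes refl | no _     = inj₂ (inj₂ refl)
        ... | no r≢s   | no r≢s⋆  = Sum.map
          (λ Or → inj₁ (Or , r≢s)) (λ Or⋆ → inj₁ (Or⋆ , r≢s⋆ ∘ cong _⋆)) (total cO Nr)
        as : ∀ {r} → Flipped r → ¬ Flipped (r ⋆)
        as (inj₁ (Or , _))  (inj₁ (Or⋆ , _)) = asym cO Or Or⋆
        as (inj₁ (_ , r≢s)) (inj₂ r⋆≡s⋆)     = r≢s (cong _⋆ r⋆≡s⋆)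
        as (inj₂ refl)      (inj₁ (_ , s≢s)) = s≢s refl
        as (inj₂ refl)      (inj₂ s≡s⋆)      = ≢⋆ Ns s≡s⋆
        -- Maximality among the disagreements with `P` is maximality in all of `O`: an element above
        -- `s` is missing from `P` too, because `P` is down-closed.
        stays : ∀ {u} → O ∋ u → s ≼ u → s ≡ u
        stays Ou s≼u = largest Ou (λ Pu → ¬Ps (down cP Ns Pu s≼u)) s≼u
        dn : ∀ {r u} → N r → Flipped u → r ≼ u → Flipped r
        dn {r} {u} Nr (inj₁ (Ou , u≢s)) r≼u =
          inj₁ (down cO Nr Ou r≼u , λ { refl → u≢s (sym (stays Ou r≼u)) })
        dn {r} Nr (inj₂ refl) r≼s⋆ with r ≟ˢ s ⋆
        ... | yes r≡s⋆ = inj₂ r≡s⋆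
        ... | no  r≢s⋆ with total cO Nr
        ...   | inj₁ Or  = inj₁ (Or , λ { refl → proper Ns (proj₁ r≼s⋆) })
        ...   | inj₂ Or⋆ = contradiction (cong _⋆ (sym (stays Or⋆ (swap r≼s⋆)))) r≢s⋆

      flipped-closer : ∣ flipped ∩ ∁ P ∣ < ∣ O ∩ ∁ P ∣
      flipped-closer = p⊂q⇒∣p∣<∣q∣
        ( ∋-⊆ (λ r r∈ → x∈p∩q⁺ (proj₁ (back r r∈) , p∩q⊆q flipped (∁ P) r∈))
        , ix s , x∈p∩q⁺ (Os , x∉p⇒x∈∁p ¬Ps) , λ s∈ → proj₂ (back s s∈) refl )
        where
        back : ∀ r → flipped ∩ ∁ P ∋ r → O ∋ r × r ≢ s
        back r r∈ with x∈p∩q⁻ flipped (∁ P) r∈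
        ... | r∈F , r∈∁P with ∋⁻ flipped? r∈F
        ...   | inj₁ r∈O = r∈O
        ...   | inj₂ refl with total cP Ns
        ...     | inj₁ Ps  = contradiction Ps ¬Ps
        ...     | inj₂ Ps⋆ = contradiction Ps⋆ (x∈∁p⇒x∉p r∈∁P)

    -- Among the elements of `O` missing from `P`, one of least weight is maximal and can be
    -- reversed.
    flip-towards : (∃[ s ] O ∋ s × ¬ P ∋ s) →
                   ∃[ s ] Σ[ O′ ∈ Orientation n ] O ∋ s × ¬ P ∋ s × Consistent O′ × Flip s O O′ ×
                          ∣ O′ ∩ ∁ P ∣ < ∣ O ∩ ∁ P ∣
    flip-towards difference with argmin {P = λ s → O ∋ s × ¬ P ∋ s} weight
      (λ m → any-pair? λ s → (O ∋? s ×-dec ¬? (P ∋? s)) ×-dec weight s <? m) difference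
    ... | s , (Os , ¬Ps) , minimal =
      s , flipped Os ¬Ps largest , Os , ¬Ps , flipped-consistent Os ¬Ps largest ,
      flipped-flip Os ¬Ps largest , flipped-closer Os ¬Ps largest
      where
      largest : ∀ {u} → O ∋ u → ¬ P ∋ u → s ≼ u → s ≡ u
      largest Ou ¬Pu s≼u = ≼-weight s≼u (minimal _ (Ou , ¬Pu))

  -- The tree: nodes, edges, connectedness and acyclicity

  abstract

    private
      nodes : List (Orientation n)
      nodes = filter consistent? (subsets (#pairs n))

    #nodes : ℕ
    #nodes = length nodes

    node : Fin #nodes → Orientation n
    node = List.lookup nodes

    node-consistent : ∀ i → Consistent (node i)
    node-consistent i = proj₂ (∈-filter⁻ consistent? {xs = subsets (#pairs n)} (∈-lookup {xs = nodes} i))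

    node-injective : ∀ {i j} → node i ≡ node j → i ≡ j
    node-injective = lookup-injective (Unique.filter⁺ consistent? (subsets-unique (#pairs n))) _ _

    find : ∀ {O} → Consistent O → Fin #nodes
    find cO = index (∈-filter⁺ consistent? (∈-subsets _) cO)

    node-find : ∀ {O} (cO : Consistent O) → node (find cO) ≡ O
    node-find cO = sym (lookup-index (∈-filter⁺ consistent? (∈-subsets _) cO))

  FlipEdge : Pair n → Fin #nodes → Fin #nodes → Set
  FlipEdge s i j = Flip s (node i) (node j)

  flipEdge-sym : ∀ {s i j} → FlipEdge s i j → FlipEdge (s ⋆) j i
  flipEdge-sym = flip-sym (node-consistent _) (node-consistent _)

  tree : Graph #nodes
  tree = record
    { Adj    = λ i j → ∃[ s ] FlipEdge s i j
    ; adj?   = λ i j → any-pair? λ s → flip? s (node i) (node j)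
    ; sym    = λ (s , f) → s ⋆ , flipEdge-sym f
    ; irrefl = λ { {i} refl (s , f) → asym (node-consistent i) (before f) (after f) }
    }

  flipEdge-unique : ∀ {s i i′ j j′} → FlipEdge s i i′ → FlipEdge s j j′ → i ≡ j
  flipEdge-unique f g = node-injective
    (flip-unique (node-consistent _) (node-consistent _) (node-consistent _) (node-consistent _) f g)

  flipEdge-unique′ : ∀ {s i i′ j j′} → FlipEdge s i i′ → FlipEdge s j j′ → i′ ≡ j′
  flipEdge-unique′ f g = flipEdge-unique (flipEdge-sym f) (flipEdge-sym g)

  ∌⇒∋⋆ : ∀ {i s} → N s → ¬ node i ∋ s → node i ∋ s ⋆
  ∌⇒∋⋆ {i} Ns ¬s with total (node-consistent i) Ns
  ... | inj₁ s∈  = contradiction s∈ ¬s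
  ... | inj₂ s⋆∈ = s⋆∈

  module _ (H : Graph #nodes) (Allowed : Pair n → Set)
           (edge : ∀ {i j s} → FlipEdge s i j → Allowed s → Adj H i j) where

    -- Disagreements with the target are reversed one at a time. Only labels on which the two ends
    -- disagree are used, so the walk stays in any graph `H` that has the edges with those labels:
    -- the tree, or the tree without one edge.
    walk-towards : ∀ i j → (∀ s → node i ∋ s → ¬ node j ∋ s → Allowed s) → Walk H i j
    walk-towards i j = go i (<-wellFounded _)
      where
      go : ∀ i → Acc _<_ ∣ node i ∩ ∁ (node j) ∣ →
           (∀ s → node i ∋ s → ¬ node j ∋ s → Allowed s) → Walk H i j
      go i (acc rec) allowed with any-pair? (λ s → node i ∋? s ×-dec ¬? (node j ∋? s))
      ... | no  same = subst (Walk H i)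
        (node-injective (consistent-≡ (node-consistent i) (node-consistent j)
          λ s s∈ → decidable-stable (node j ∋? s) λ s∉ → same (s , s∈ , s∉))) [ i ]
      ... | yes difference
        with flip-towards (node-consistent i) (node-consistent j) difference
      ...   | s , O′ , s∈ , s∉ , cO′ , f , closer = step
        (edge f′ (allowed s s∈ s∉))
        (go (find cO′) (rec (subst (λ O → ∣ O ∩ ∁ (node j) ∣ < _) (sym (node-find cO′)) closer)) allowed′)
        where
        f′ : FlipEdge s i (find cO′)
        f′ = subst (Flip s (node i)) (sym (node-find cO′)) f
        -- The only new element is `s ⋆`, and `node j` contains it, so every remaining disagreement
        -- is an old one.
        allowed′ : ∀ r → node (find cO′) ∋ r → ¬ node j ∋ r → Allowed r
        allowed′ r r∈ r∉ with r ≟ˢ s ⋆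
        ... | yes refl = contradiction (∌⇒∋⋆ (member (node-consistent i) s∈) s∉) r∉
        ... | no  r≢s⋆ = allowed r (agree (flipEdge-sym f′) r r≢s⋆ r∈) r∉

  -- Along an edge, membership of `s` can be lost only if `s` is the label.
  crossing : ∀ {i j} (p : Walk tree i j) {s} → node i ∋ s → ¬ node j ∋ s →
             ∃[ e ] ∃[ e′ ] FlipEdge s e e′ × e List.∈ vertices p × e′ List.∈ vertices p
  crossing [ _ ] s∈ s∉ = contradiction s∈ s∉
  crossing (step {v = w} (r , f) p) {s} s∈ s∉ with node w ∋? s
  ... | yes s∈w = let e , e′ , g , e∈ , e′∈ = crossing p s∈w s∉ in e , e′ , g , there e∈ , there e′∈
  ... | no  s∉w with refl ← flip-label (node-consistent _) (node-consistent _) f s∈ s∉w =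
    _ , w , f , here refl , there (first∈ p)

  -- If the first step keeps `s`, the rest of the path must use the edge labelled `s`, which starts
  -- at `u`, so `u` is repeated. If it loses `s`, it leads straight to `v`, and the rest of the path
  -- is trivial.
  no-cycle : ∀ {s u v} → FlipEdge s u v → (p : Walk tree u v) → IsPath p → ¬ 3 ≤ length (vertices p)
  no-cycle g [ _ ] _ (s≤s ())
  no-cycle {s} {u} {v} g (step {v = w} (r , f) p) (u∉ ∷ path) 3≤ with node w ∋? s
  ... | yes s∈w with crossing p s∈w (λ s∈v → asym (node-consistent v) s∈v (after g))
  ...   | e , _ , h , e∈ , _ with refl ← flipEdge-unique g h = contradiction refl (All.lookup u∉ e∈)
  no-cycle {s} {u} {v} g (step {v = w} (r , f) p) (u∉ ∷ path) 3≤ | no s∉w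
    with refl ← flip-label (node-consistent _) (node-consistent _) f (before g) s∉w
    with refl ← flipEdge-unique′ f g = trivial p path 3≤
    where
    trivial : (p : Walk tree v v) → IsPath p → ¬ 3 ≤ suc (length (vertices p))
    trivial [ _ ]      _        (s≤s (s≤s ()))
    trivial (step _ q) (v∉ ∷ _) _ = contradiction refl (All.lookup v∉ (last∈ q))

  -- A path would have to use the edge of s twice.
  path-convex : ∀ {i j} (p : Walk tree i j) → IsPath p → ∀ {m} → m List.∈ vertices p →
                ∀ {s} → ¬ node i ∋ s → ¬ node j ∋ s → ¬ node m ∋ s
  path-convex [ _ ]      _ (here refl) i∌s _ = i∌s
  path-convex (step _ _) _ (here refl) i∌s _ = i∌s
  path-convex (step {v = w} (r , f) p) (i∉ ∷ path) (there m∈) {s} i∌s j∌s with node w ∋? s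
  ... | no  w∌s = path-convex p path m∈ w∌s j∌s
  ... | yes w∋s with refl ← flip-label (node-consistent _) (node-consistent _) (flipEdge-sym f) w∋s i∌s
                with crossing p w∋s j∌s
  ...   | _ , e′ , h , _ , e′∈ with refl ← flipEdge-unique′ (flipEdge-sym f) h =
    contradiction refl (All.lookup i∉ e′∈)

  -- Parts and adhesion sets

  inPart? : ∀ i → Decidable (λ v → ∀ s → node i ∋ s → v ∈ proj₂ s)
  inPart? i v = all-pairs? λ s → node i ∋? s →-dec v ∈? proj₂ s

  part : Fin #nodes → Subset n
  part i = comprehension (inPart? i)

  ∈part⁺ : ∀ {i v} → (∀ s → node i ∋ s → v ∈ proj₂ s) → v ∈ part i
  ∈part⁺ = ∈-comprehension⁺ (inPart? _)

  ∈part⁻ : ∀ {i v} → v ∈ part i → ∀ s → node i ∋ s → v ∈ proj₂ s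
  ∈part⁻ = ∈-comprehension⁻ (inPart? _)

  Sided : Subset n → Set
  Sided X = ∀ {s} → N s → X ⊆ proj₁ s ⊎ X ⊆ proj₂ s

  module _ {X : Subset n} (sided : Sided X) where

    -- When `X` lies in the separator, both directions point to it and `Preferred` decides. This
    -- tie-break depends on a numbering but only exhibits certain nodes; the tree and its parts are
    -- defined without it.
    Towards : Pair n → Set
    Towards s = N s × X ⊆ proj₂ s × (¬ X ⊆ proj₁ s ⊎ Preferred s)

    towards? : Decidable Towards
    towards? s = N? s ×-dec X ⊆? proj₂ s ×-dec (¬? (X ⊆? proj₁ s) ⊎-dec preferred? s)

    towards-consistent : Consistent (orientation towards?)
    towards-consistent = record
      { member = λ s∈ → proj₁ (∋⁻ towards? s∈)
      ; total  = λ Ns → Sum.map (∋⁺ towards?) (∋⁺ towards?) (tot Ns)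
      ; asym   = λ s∈ s⋆∈ → as (∋⁻ towards? s∈) (∋⁻ towards? s⋆∈)
      ; down   = λ Nr s∈ r≼s → ∋⁺ towards? (dn Nr (∋⁻ towards? s∈) r≼s) }
      where
      tot : ∀ {s} → N s → Towards s ⊎ Towards (s ⋆)
      tot {s} Ns with X ⊆? proj₁ s | X ⊆? proj₂ s
      ... | no X⊈A  | no X⊈B  = contradiction (sided Ns) Sum.[ X⊈A , X⊈B ]
      ... | no X⊈A  | yes X⊆B = inj₁ (Ns , X⊆B , inj₁ X⊈A)
      ... | yes X⊆A | no X⊈B  = inj₂ (N-⋆ Ns , X⊆A , inj₁ X⊈B)
      ... | yes X⊆A | yes X⊆B = Sum.map (λ pr → Ns , X⊆B , inj₂ pr) (λ pr → N-⋆ Ns , X⊆A , inj₂ pr)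
        (preferred-total s (≢⋆ Ns))
      as : ∀ {s} → Towards s → ¬ Towards (s ⋆)
      as (_ , _ , inj₁ X⊈A) (_ , X⊆A , _) = X⊈A X⊆A
      as (_ , X⊆B , _) (_ , _ , inj₁ X⊈B) = X⊈B X⊆B
      as {s} (_ , _ , inj₂ pr) (_ , _ , inj₂ pr⋆) = preferred-asym s pr pr⋆
      dn : ∀ {r s} → N r → Towards s → r ≼ s → Towards r
      dn Nr (_ , X⊆B , inj₁ X⊈A) (C⊆A , B⊆D) =
        Nr , ⊆-trans X⊆B B⊆D , inj₁ λ X⊆C → X⊈A (⊆-trans X⊆C C⊆A)
      dn {r} {s} Nr (_ , X⊆B , inj₂ pr) (C⊆A , B⊆D) =
        Nr , ⊆-trans X⊆B B⊆D , inj₂ (preferred-down {r = r} {s} (C⊆A , B⊆D) pr)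

    towards : Fin #nodes
    towards = find towards-consistent

    towards∋⁺ : ∀ {s} → N s → X ⊆ proj₂ s → ¬ X ⊆ proj₁ s → node towards ∋ s
    towards∋⁺ {s} Ns X⊆B X⊈A = subst (_∋ s) (sym (node-find towards-consistent))
      (∋⁺ towards? (Ns , X⊆B , inj₁ X⊈A))

    ⊆part-towards : X ⊆ part towards
    ⊆part-towards x∈ = ∈part⁺ λ s s∈ →
      proj₁ (proj₂ (∋⁻ towards? (subst (_∋ s) (node-find towards-consistent) s∈))) x∈

  together-sided : ∀ {u v} → Close G u v → Sided (⁅ u ⁆ ∪ ⁅ v ⁆)
  together-sided close Ns = Sum.map both both (together (separation Ns) _ _ close)
    where
    both : ∀ {A u v} → u ∈ A × v ∈ A → ⁅ u ⁆ ∪ ⁅ v ⁆ ⊆ A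
    both (u∈ , v∈) = ∪-lub (⁅x⁆⊆ u∈) (⁅x⁆⊆ v∈)

  covered : ∀ {u v} → Close G u v → ∃[ t ] u ∈ part t × v ∈ part t
  covered {u} {v} close = towards (together-sided close) ,
    ⊆part-towards (together-sided close) (x∈p∪q⁺ (inj₁ (x∈⁅x⁆ u))) ,
    ⊆part-towards (together-sided close) (x∈p∪q⁺ (inj₂ (x∈⁅x⁆ v)))

  -- Every separation at a node of the path already belongs to one of the two ends.
  parts-convex : ∀ {i j} (p : Walk tree i j) → IsPath p → ∀ {m} → m List.∈ vertices p →
                 part i ∩ part j ⊆ part m
  parts-convex {i} {j} p path {m} m∈ {v} v∈ = ∈part⁺ inside
    where
    v∈ᵢ = proj₁ (x∈p∩q⁻ (part i) (part j) v∈)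
    v∈ⱼ = proj₂ (x∈p∩q⁻ (part i) (part j) v∈)
    inside : ∀ s → node m ∋ s → v ∈ proj₂ s
    inside s s∈ with node i ∋? s | node j ∋? s
    ... | yes i∋s | _       = ∈part⁻ v∈ᵢ s i∋s
    ... | no  _   | yes j∋s = ∈part⁻ v∈ⱼ s j∋s
    ... | no  i∌s | no  j∌s = contradiction s∈ (path-convex p path m∈ i∌s j∌s)

  treeDecomposition : TreeDecomposition G
  treeDecomposition = record
    { tree      = tree
    ; isTree    = record
      -- The empty set lies on a side of every separation, so it supplies a node.
      { node      = towards {⊥} λ _ → inj₁ (⊆-min _)
      ; connected = λ i j → walk-towards tree (λ _ → ⊤) (λ f _ → _ , f) i j λ _ _ _ → tt
      ; acyclic   = λ p path 3≤ (_ , f) → no-cycle (flipEdge-sym f) p path 3≤ }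
    ; part      = part
    ; coverV    = λ v → let t , v∈ , _ = covered {v} (inj₁ refl) in t , v∈
    ; coverE    = λ adj → covered (inj₂ adj)
    ; connected = parts-convex
    }

  -- Every `r` at `node i` lies below `s` or below `s ⋆`, so its second side contains a whole side
  -- of `s`, and with it the separator.
  flipEdge-separator⊆ : ∀ {s i j} → FlipEdge s i j → proj₁ s ∩ proj₂ s ⊆ part i
  flipEdge-separator⊆ {s} {i} {j} f {v} v∈ = ∈part⁺ inside
    where
    cᵢ = node-consistent i
    v∈A = proj₁ (x∈p∩q⁻ (proj₁ s) (proj₂ s) v∈)
    v∈B = proj₂ (x∈p∩q⁻ (proj₁ s) (proj₂ s) v∈)
    inside : ∀ r → node i ∋ r → v ∈ proj₂ r
    inside r r∈ with nested (member cᵢ r∈) (member cᵢ (before f))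
    ... | ≼⁺⁺ r≼s = proj₂ r≼s v∈B
    ... | ≼⁺⁻ r≼s⋆ = proj₂ r≼s⋆ v∈A
    ... | ≼⁻⁺ r⋆≼s = contradiction (down cᵢ (N-⋆ (member cᵢ r∈)) (before f) r⋆≼s) (asym cᵢ r∈)
    ... | ≼⁻⁻ r⋆≼s⋆ with r ≟ˢ s
    ...   | yes refl = v∈B
    ...   | no  r≢s  = contradiction
      (down (node-consistent j) (N-⋆ (member cᵢ r∈)) (after f) r⋆≼s⋆)
      (asym (node-consistent j) (agree f r r≢s r∈))

  flipEdge-adhesion : ∀ {s i j} → FlipEdge s i j → part i ∩ part j ≡ proj₁ s ∩ proj₂ s
  flipEdge-adhesion {s} {i} {j} f = ⊆-antisym
    (λ v∈ → let v∈ᵢ , v∈ⱼ = x∈p∩q⁻ (part i) (part j) v∈ in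
      x∈p∩q⁺ (∈part⁻ v∈ⱼ (s ⋆) (after f) , ∈part⁻ v∈ᵢ s (before f)))
    (λ v∈ → x∈p∩q⁺ ( flipEdge-separator⊆ f v∈
                   , flipEdge-separator⊆ (flipEdge-sym f) (subst (_ ∈_) (∩-comm (proj₁ s) (proj₂ s)) v∈)))

  adhesion<k : ∀ {k} → (∀ {s} → N s → order s < k) → HasAdhesionBelow treeDecomposition k
  adhesion<k small (s , f) = subst (_< _) (sym (cong ∣_∣ (flipEdge-adhesion f)))
    (small (member (node-consistent _) (before f)))

  -- Both ends contain `s`, so neither `s` nor `s ⋆` is a disagreement, and the deleted edge carries
  -- no other label.
  side-walk : ∀ {s i j m} → FlipEdge s i j → node m ∋ s → Walk (deleteEdge i j tree) i m
  side-walk {s} {i} {j} {m} f m∋s = walk-towards (deleteEdge i j tree) (λ r → r ≢ s × r ≢ s ⋆) edge i m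
    λ r i∋r m∌r → (λ { refl → m∌r m∋s }) , (λ { refl → asym (node-consistent i) (before f) i∋r })
    where
    label : ∀ {r u i j} → FlipEdge u i j → FlipEdge r i j → u ≡ r
    label g h = flip-label (node-consistent _) (node-consistent _) g (before h)
      (λ r∈ → asym (node-consistent _) r∈ (after h))
    edge : ∀ {e e′ r} → FlipEdge r e e′ → r ≢ s × r ≢ s ⋆ → Adj (deleteEdge i j tree) e e′
    edge g (r≢s , r≢s⋆) = (_ , g) , λ where
      (inj₁ (refl , refl)) → r≢s (label g f)
      (inj₂ (refl , refl)) → r≢s⋆ (label g (flipEdge-sym f))

  deleteEdge-swap : ∀ {i j u v} → Walk (deleteEdge j i tree) u v → Walk (deleteEdge i j tree) u v
  deleteEdge-swap [ u ]               = [ u ]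
  deleteEdge-swap (step (a , ¬e) p) = step (a , ¬e ∘ Sum.swap) (deleteEdge-swap p)

  -- The node towards `X` contains `s ⋆` and the node towards `Y` contains `s`. A walk between them
  -- uses the edge labelled `s ⋆`, and each of these nodes is reached from its own end of that edge.
  separated : ∀ {X Y s} → Sided X → Sided Y → N s → X ⊆ proj₁ s → ¬ X ⊆ proj₂ s →
              Y ⊆ proj₂ s → ¬ Y ⊆ proj₁ s →
              ∃[ i ] ∃[ j ] FlipEdge (s ⋆) i j × OnDifferentSides treeDecomposition i j X Y
  separated {X} {Y} {s} sX sY Ns X⊆A X⊈B Y⊆B Y⊈A
    with towards∋⁺ sX (N-⋆ Ns) X⊆A X⊈B | towards∋⁺ sY Ns Y⊆B Y⊈A
  ... | x∋s⋆ | y∋s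
    with crossing (walk-towards tree (λ _ → ⊤) (λ f _ → _ , f) (towards sX) (towards sY) (λ _ _ _ → tt))
                  x∋s⋆ (asym (node-consistent _) y∋s)
  ...   | i , j , f , _ = i , j , f ,
    (towards sX , side-walk f x∋s⋆ , ⊆part-towards sX) ,
    (towards sY , deleteEdge-swap (side-walk (flipEdge-sym f) y∋s) , ⊆part-towards sY)

  part-towards-≡ : ∀ {X} (sX : Sided X) →
    (∀ v → v ∉ X → ∃[ s ] N s × X ⊆ proj₂ s × ¬ X ⊆ proj₁ s × v ∉ proj₂ s) → part (towards sX) ≡ X
  part-towards-≡ {X} sX cut-off = ⊆-antisym inside (⊆part-towards sX)
    where
    inside : part (towards sX) ⊆ X
    inside {v} v∈ with v ∈? X
    ... | yes v∈X = v∈X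
    ... | no  v∉X = let s , Ns , X⊆B , X⊈A , v∉B = cut-off v v∉X in
      contradiction (∈part⁻ v∈ s (towards∋⁺ sX Ns X⊆B X⊈A)) v∉B

-- Symmetries

∣∣-sum : ∀ {n} (X : Subset n) → ∣ X ∣ ≡ sum (List.tabulate λ v → if lookup X v then 1 else 0)
∣∣-sum []          = refl
∣∣-sum (true  ∷ X) = cong suc (∣∣-sum X)
∣∣-sum (false ∷ X) = ∣∣-sum X

module _ {n : ℕ} where

  act : Permutation′ n → Pair n → Pair n
  act α (A , B) = image α A , image α B

  module _ (α : Permutation′ n) where

    ∈-image⁻ : ∀ {X v} → v ∈ image α X → α ⟨$⟩ˡ v ∈ X
    ∈-image⁻ {X} {v} v∈ =
      Vec.lookup⇒[]= _ X (trans (sym (Vec.lookup∘tabulate _ v)) (Vec.[]=⇒lookup v∈))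

    ∈-image⁺ : ∀ {X v} → α ⟨$⟩ˡ v ∈ X → v ∈ image α X
    ∈-image⁺ {X} {v} v∈ =
      Vec.lookup⇒[]= v _ (trans (Vec.lookup∘tabulate _ v) (Vec.[]=⇒lookup v∈))

    ∈-image : ∀ {X v} → v ∈ X → α ⟨$⟩ʳ v ∈ image α X
    ∈-image {X} v∈ = ∈-image⁺ (subst (_∈ X) (sym (inverseˡ α)) v∈)

    image-mono : ∀ {X Y} → X ⊆ Y → image α X ⊆ image α Y
    image-mono X⊆Y v∈ = ∈-image⁺ (X⊆Y (∈-image⁻ v∈))

    image-∩ : ∀ X Y → image α (X ∩ Y) ≡ image α X ∩ image α Y
    image-∩ X Y = ⊆-antisym
      (λ v∈ → let v∈X , v∈Y = x∈p∩q⁻ X Y (∈-image⁻ v∈) in x∈p∩q⁺ (∈-image⁺ v∈X , ∈-image⁺ v∈Y))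
      (λ v∈ → let v∈X , v∈Y = x∈p∩q⁻ (image α X) (image α Y) v∈ in
        ∈-image⁺ {X ∩ Y} (x∈p∩q⁺ (∈-image⁻ v∈X , ∈-image⁻ v∈Y)))

    ∣image∣ : ∀ X → ∣ image α X ∣ ≡ ∣ X ∣
    ∣image∣ X = begin
      ∣ image α X ∣                           ≡⟨ ∣∣-map (image α X) ⟩
      sum (List.map (bit (image α X)) fins)   ≡⟨ cong sum (List.map-cong bit-image fins) ⟩
      sum (List.map (bit X ∘ (α ⟨$⟩ˡ_)) fins) ≡⟨ sum-map-reindex (Unique.allFin⁺ n) ∈-allFin
                                                   (α ⟨$⟩ˡ_) (α ⟨$⟩ʳ_) (λ _ → inverseˡ α) (λ _ → inverseʳ α) (bit X) ⟩
      sum (List.map (bit X) fins)             ≡⟨ sym (∣∣-map X) ⟩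
      ∣ X ∣                                   ∎
      where
      open ≡-Reasoning
      fins : List (Fin n)
      fins = List.allFin n
      bit : Subset n → Fin n → ℕ
      bit X v = if lookup X v then 1 else 0
      bit-image : ∀ v → bit (image α X) v ≡ bit X (α ⟨$⟩ˡ v)
      bit-image v = cong (if_then 1 else 0) (Vec.lookup∘tabulate _ v)
      ∣∣-map : ∀ X → ∣ X ∣ ≡ sum (List.map (bit X) fins)
      ∣∣-map X = trans (∣∣-sum X) (cong sum (sym (List.map-tabulate (λ v → v) (bit X))))

    act-mono : ∀ {s t} → s ≼ t → act α s ≼ act α t
    act-mono (le₁ , le₂) = image-mono le₁ , image-mono le₂

    order-act : ∀ s → order (act α s) ≡ order s
    order-act (A , B) = trans (cong ∣_∣ (sym (image-∩ A B))) (∣image∣ (A ∩ B))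

    nested-act : ∀ {s t} → Nested s t → Nested (act α s) (act α t)
    nested-act (≼⁺⁺ le) = ≼⁺⁺ (act-mono le)
    nested-act (≼⁺⁻ le) = ≼⁺⁻ (act-mono le)
    nested-act (≼⁻⁻ le) = ≼⁻⁻ (act-mono le)
    nested-act (≼⁻⁺ le) = ≼⁻⁺ (act-mono le)

  image-inverse : ∀ α X → image α (image (Perm.flip α) X) ≡ X
  image-inverse α X = ⊆-antisym
    (λ v∈ → subst (_∈ X) (inverseʳ α) (∈-image⁻ (Perm.flip α) (∈-image⁻ α v∈)))
    (λ v∈ → ∈-image⁺ α (∈-image⁺ (Perm.flip α) (subst (_∈ X) (sym (inverseʳ α)) v∈)))

  image-⊆ : ∀ α {X Y} → X ⊆ image (Perm.flip α) Y → image α X ⊆ Y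
  image-⊆ α {X} {Y} X⊆ = subst (image α X ⊆_) (image-inverse α Y) (image-mono α X⊆)

  ⊆-image : ∀ α {X Y} → image (Perm.flip α) X ⊆ Y → X ⊆ image α Y
  ⊆-image α {X} {Y} ⊆Y = subst (_⊆ image α Y) (image-inverse α X) (image-mono α ⊆Y)

  act-inverse : ∀ α s → act α (act (Perm.flip α) s) ≡ s
  act-inverse α (A , B) = cong₂ _,_ (image-inverse α A) (image-inverse α B)

  nested-act⁻ : ∀ α {s t} → Nested (act α s) (act α t) → Nested s t
  nested-act⁻ α {s} {t} ns = subst₂ Nested
    (act-inverse (Perm.flip α) s) (act-inverse (Perm.flip α) t) (nested-act (Perm.flip α) ns)

  -- The permutation preserves nestedness and permutes the set of all pairs, against which crossings
  -- are counted.
  crossings-act : ∀ α s → crossings (act α s) ≡ crossings s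
  crossings-act α s = begin
    sum (List.map (λ r → χ r (act α s)) (pairs n))
      ≡⟨ sym (sum-map-reindex (pairs-unique n) ∈-pairs (act α) (act (Perm.flip α))
                (act-inverse α) (act-inverse (Perm.flip α)) (λ r → χ r (act α s))) ⟩
    sum (List.map (λ r → χ (act α r) (act α s)) (pairs n))
      ≡⟨ cong sum (List.map-cong (λ r → χ-cong (nested-act⁻ α {r} {s}) (nested-act α {r} {s})) (pairs n)) ⟩
    sum (List.map (λ r → χ r s) (pairs n)) ∎
    where open ≡-Reasoning

least-act : ∀ {n} {F F′ : Pair n → Set} α → (∀ {u} → F u → F′ (act α u)) →
            (∀ {u} → F′ u → F (act (Perm.flip α) u)) → ∀ {s} → Least F s → Least F′ (act α s)
least-act α = least-map (act α) (act (Perm.flip α)) (crossings-act α) (crossings-act (Perm.flip α))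

flip-automorphism : ∀ {n} {G : Graph n} {α} → IsAutomorphism G α → IsAutomorphism G (Perm.flip α)
flip-automorphism {G = G} {α} aut u v = mk⇔
  (λ adj → Equivalence.from (aut _ _) (subst₂ (Adj G) (sym (inverseʳ α)) (sym (inverseʳ α)) adj))
  (λ adj → subst₂ (Adj G) (inverseʳ α) (inverseʳ α) (Equivalence.to (aut _ _) adj))

module TreeSymmetry {n : ℕ} {G : Graph n} (𝒩 : NestedSet G) where
  open NestedSet 𝒩
  open Tree 𝒩
  open Consistent
  open Flip

  Invariant : Permutation′ n → Set
  Invariant α = ∀ {s} → N s → N (act α s)

  module _ (α : Permutation′ n) (inv : Invariant α) (inv⁻ : Invariant (Perm.flip α)) where
    private
      α⁻¹ : Permutation′ n
      α⁻¹ = Perm.flip α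

    -- The image of the orientation `O` under `α`, described through preimages.
    moved? : ∀ O → Decidable (λ s → O ∋ act α⁻¹ s)
    moved? O s = O ∋? act α⁻¹ s

    moved-consistent : ∀ {O} → Consistent O → Consistent (orientation (moved? O))
    moved-consistent {O} cO = record
      { member = λ {s} s∈ → subst N (act-inverse α s) (inv (member cO (∋⁻ (moved? O) s∈)))
      ; total  = λ Ns → Sum.map (∋⁺ (moved? O)) (∋⁺ (moved? O)) (total cO (inv⁻ Ns))
      ; asym   = λ s∈ s⋆∈ → asym cO (∋⁻ (moved? O) s∈) (∋⁻ (moved? O) s⋆∈)
      ; down   = λ Nr s∈ r≼s → ∋⁺ (moved? O)
                   (down cO (inv⁻ Nr) (∋⁻ (moved? O) s∈) (act-mono α⁻¹ r≼s)) }

    moveNode : Fin #nodes → Fin #nodes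
    moveNode i = find (moved-consistent (node-consistent i))

    ∋-moveNode⁺ : ∀ {i s} → node i ∋ act α⁻¹ s → node (moveNode i) ∋ s
    ∋-moveNode⁺ {i} {s} s∈ = subst (_∋ s) (sym (node-find (moved-consistent (node-consistent i))))
      (∋⁺ (moved? (node i)) s∈)

    ∋-moveNode⁻ : ∀ {i s} → node (moveNode i) ∋ s → node i ∋ act α⁻¹ s
    ∋-moveNode⁻ {i} {s} s∈ = ∋⁻ (moved? (node i))
      (subst (_∋ s) (node-find (moved-consistent (node-consistent i))) s∈)

    ∋-moveNode : ∀ {i s} → node i ∋ s → node (moveNode i) ∋ act α s
    ∋-moveNode {i} {s} s∈ = ∋-moveNode⁺ (subst (node i ∋_) (sym (act-inverse α⁻¹ s)) s∈)

    moveNode-flip : ∀ {s i j} → FlipEdge s i j → FlipEdge (act α s) (moveNode i) (moveNode j)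
    moveNode-flip {s} f = record
      { before = ∋-moveNode (before f)
      ; after  = ∋-moveNode (after f)
      ; agree  = λ r r≢ r∈ → ∋-moveNode⁺ (agree f (act α⁻¹ r)
          (λ eq → r≢ (trans (sym (act-inverse α r)) (cong (act α) eq))) (∋-moveNode⁻ r∈)) }

    part-moveNode : ∀ i → image α (part i) ≡ part (moveNode i)
    part-moveNode i = ⊆-antisym
      (λ v∈ → ∈part⁺ λ s s∈ → subst (_ ∈_) (image-inverse α (proj₂ s))
        (∈-image⁺ α (∈part⁻ (∈-image⁻ α v∈) (act α⁻¹ s) (∋-moveNode⁻ s∈))))
      (λ v∈ → ∈-image⁺ α (∈part⁺ λ s s∈ → ∈-image⁻ α (∈part⁻ v∈ (act α s) (∋-moveNode s∈))))

  moveNode-inverse : ∀ α (inv : Invariant α) (inv⁻ : Invariant (Perm.flip α)) i →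
                     moveNode α inv inv⁻ (moveNode (Perm.flip α) inv⁻ inv i) ≡ i
  moveNode-inverse α inv inv⁻ i = node-injective
    (consistent-≡ (node-consistent _) (node-consistent i) λ s s∈ →
      subst (node i ∋_) (act-inverse α s)
        (∋-moveNode⁻ (Perm.flip α) inv⁻ inv (∋-moveNode⁻ α inv inv⁻ s∈)))

  canonical : (∀ α → IsAutomorphism G α → Invariant α) → IsCanonical treeDecomposition
  canonical invariant α aut =
    permutation (moveNode α inv inv⁻) (moveNode α⁻¹ inv⁻ inv)
      (moveNode-inverse α inv inv⁻) (moveNode-inverse α⁻¹ inv⁻ inv) ,
    (λ i j → mk⇔
      (λ (s , f) → act α s , moveNode-flip α inv inv⁻ f)
      (λ (s , f) → subst₂ (Adj tree) (moveNode-inverse α⁻¹ inv⁻ inv i) (moveNode-inverse α⁻¹ inv⁻ inv j)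
                     (act α⁻¹ s , moveNode-flip α⁻¹ inv⁻ inv f))) ,
    part-moveNode α inv inv⁻
    where
    α⁻¹ : Permutation′ n
    α⁻¹ = Perm.flip α
    inv : Invariant α
    inv = invariant α aut
    inv⁻ : Invariant α⁻¹
    inv⁻ = invariant α⁻¹ (flip-automorphism {G = G} {α} aut)

-- Walks

module _ {n : ℕ} {G : Graph n} where

  _++ʷ_ : ∀ {u v w} → Walk G u v → Walk G v w → Walk G u w
  [ _ ]    ++ʷ q = q
  step e p ++ʷ q = step e (p ++ʷ q)

  ∈-++ʷ : ∀ {u v w x} (p : Walk G u v) (q : Walk G v w) → x List.∈ vertices (p ++ʷ q) →
          x List.∈ vertices p ⊎ x List.∈ vertices q
  ∈-++ʷ [ _ ]      q x∈          = inj₂ x∈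
  ∈-++ʷ (step e p) q (here x≡)   = inj₁ (here x≡)
  ∈-++ʷ (step e p) q (there x∈)  = Sum.map₁ there (∈-++ʷ p q x∈)

  record Shortcut {u v} (p : Walk G u v) (x : Fin n) : Set where
    field
      walk   : Walk G x v
      isPath : IsPath walk
      within : ∀ {w} → w List.∈ vertices walk → w List.∈ vertices p

  suffix : ∀ {u v} (p : Walk G u v) → IsPath p → ∀ {x} → x List.∈ vertices p → Shortcut p x
  suffix p@([ _ ])    path       (here refl) = record { walk = p ; isPath = path ; within = λ w∈ → w∈ }
  suffix p@(step _ _) path       (here refl) = record { walk = p ; isPath = path ; within = λ w∈ → w∈ }
  suffix (step _ p)   (_ ∷ path) (there x∈)  =
    let open Shortcut (suffix p path x∈) in
    record { walk = walk ; isPath = isPath ; within = there ∘ within }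

  toPath : ∀ {u v} (p : Walk G u v) → Shortcut p u
  toPath [ u ] = record { walk = [ u ] ; isPath = [] ∷ [] ; within = λ w∈ → w∈ }
  toPath (step {u = u} e p) with toPath p
  ... | record { walk = q ; isPath = path ; within = within }
    with Any.any? (u Fin.≟_) (vertices q)
  ...   | yes u∈ = let open Shortcut (suffix q path u∈) using () renaming (walk to r; isPath to path′; within to within′) in
    record { walk = r ; isPath = path′ ; within = there ∘ within ∘ within′ }
  ...   | no  u∉ = record
    { walk = step e q
    ; isPath = All.tabulate (λ w∈ u≡w → u∉ (subst (List._∈ vertices q) (sym u≡w) w∈)) ∷ path
    ; within = λ { (here w≡) → here w≡ ; (there w∈) → there (within w∈) } }

  -- A walk that starts in the first side stays there until some step lies in the second; the vertex
  -- before that step, or else the end of the walk, is in both.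
  split⇒separates : ∀ {X Y s} → Split G X Y s → Separates G (proj₁ s ∩ proj₂ s) X Y
  split⇒separates {s = s} (sep , X⊆A , Y⊆B) x∈ y∈ p _ = meets p (X⊆A x∈) (Y⊆B y∈)
    where
    meets : ∀ {u v} (p : Walk G u v) → u ∈ proj₁ s → v ∈ proj₂ s →
            Any (_∈ proj₁ s ∩ proj₂ s) (vertices p)
    meets [ _ ] u∈A u∈B = here (x∈p∩q⁺ (u∈A , u∈B))
    meets (step e p) u∈A w∈B with together sep _ _ (inj₂ e)
    ... | inj₁ (_ , v∈A) = there (meets p v∈A w∈B)
    ... | inj₂ (u∈B , _) = here (x∈p∩q⁺ (u∈A , u∈B))

  PathInto : Subset n → Subset n → Fin n → Set
  PathInto Y R v = ∃[ y ] y ∈ Y × Σ[ p ∈ Walk G v y ] IsPath p ×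
                     (∀ w → w List.∈ vertices p → w ∈ R)

  -- `R` is the union of the components of `G - S` that meet `Y`.
  record Reach (S Y : Subset n) : Set where
    field
      R      : Subset n
      avoids : ∀ {v} → v ∈ R → v ∉ S
      start  : ∀ {v} → v ∈ Y → v ∈ R ⊎ v ∈ S
      closed : ∀ {u v} → u ∈ R → Adj G u v → v ∈ R ⊎ v ∈ S
      path   : ∀ {v} → v ∈ R → PathInto Y R v

  reach : ∀ S Y → Reach S Y
  reach S Y = grow (Y ∩ ∁ S) (<-wellFounded _)
      (λ v∈ → x∈∁p⇒x∉p (p∩q⊆q Y (∁ S) v∈))
      start
      (λ {v} v∈ → v , p∩q⊆p Y (∁ S) v∈ , [ v ] , [] ∷ [] , λ { _ (here refl) → v∈ })
    where
    start : ∀ {v} → v ∈ Y → v ∈ Y ∩ ∁ S ⊎ v ∈ S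
    start {v} v∈Y with v ∈? S
    ... | yes v∈S = inj₂ v∈S
    ... | no  v∉S = inj₁ (x∈p∩q⁺ (v∈Y , x∉p⇒x∈∁p v∉S))
    grow : ∀ R → Acc _<_ ∣ ∁ R ∣ → (∀ {v} → v ∈ R → v ∉ S) → (∀ {v} → v ∈ Y → v ∈ R ⊎ v ∈ S) →
           (∀ {v} → v ∈ R → PathInto Y R v) → Reach S Y
    grow R (acc rec) avoids start path
      with Fin.any? (λ u → Fin.any? λ v → u ∈? R ×-dec Graph.adj? G u v ×-dec ¬? (v ∈? R) ×-dec ¬? (v ∈? S))
    ... | no  none = record
      { R = R ; avoids = avoids ; start = start ; closed = closed ; path = path }
      where
      closed : ∀ {u v} → u ∈ R → Adj G u v → v ∈ R ⊎ v ∈ S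
      closed {u} {v} u∈R e with v ∈? R | v ∈? S
      ... | yes v∈R | _       = inj₁ v∈R
      ... | no  _   | yes v∈S = inj₂ v∈S
      ... | no  v∉R | no  v∉S = contradiction (u , v , u∈R , e , v∉R , v∉S) none
    ... | yes (u , v , u∈R , e , v∉R , v∉S) = grow (R ∪ ⁅ v ⁆) (rec closer)
      (λ w∈ → Sum.[ avoids , (λ w∈v → subst (_∉ S) (sym (x∈⁅y⁆⇒x≡y v w∈v)) v∉S) ] (x∈p∪q⁻ R ⁅ v ⁆ w∈))
      (λ y∈ → Sum.map₁ grown (start y∈))
      (λ w∈ → Sum.[ (λ w∈R → let y , y∈ , p , isp , within = path w∈R in
                       y , y∈ , p , isp , λ x x∈ → grown (within x x∈))
                  , (λ w∈v → subst (PathInto Y (R ∪ ⁅ v ⁆)) (sym (x∈⁅y⁆⇒x≡y v w∈v)) extended) ]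
              (x∈p∪q⁻ R ⁅ v ⁆ w∈))
      where
      grown : ∀ {w} → w ∈ R → w ∈ R ∪ ⁅ v ⁆
      grown w∈ = x∈p∪q⁺ (inj₁ w∈)
      new : v ∈ R ∪ ⁅ v ⁆
      new = x∈p∪q⁺ (inj₂ (x∈⁅x⁆ v))
      closer : ∣ ∁ (R ∪ ⁅ v ⁆) ∣ < ∣ ∁ R ∣
      closer = p⊂q⇒∣p∣<∣q∣ (p⊆q⇒∁p⊇∁q (p⊆p∪q ⁅ v ⁆) , v , x∉p⇒x∈∁p v∉R , λ v∈ → x∈∁p⇒x∉p v∈ new)
      extended : PathInto Y (R ∪ ⁅ v ⁆) v
      extended = let y , y∈ , p , isp , within = path u∈R in
        y , y∈ , step (Graph.sym G e) p ,
        All.tabulate (λ x∈ v≡x → v∉R (subst (_∈ R) (sym v≡x) (within _ x∈))) ∷ isp ,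
        λ { _ (here refl) → new ; x (there x∈) → grown (within x x∈) }

  -- Edges leave `R` only towards `S`, so the complement of `R` and `R ∪ S` form a separation with
  -- separator `S`. A vertex of `X` in `R` would have a path to `Y` inside `R`, which misses `S`.
  separates⇒split : ∀ {S X Y} → Separates G S X Y → ∃[ s ] Split G X Y s × proj₁ s ∩ proj₂ s ≡ S
  separates⇒split {S} {X} {Y} separates = (∁ R , R ∪ S) , (mkSeparation sides , X⊆ , Y⊆) ,
      ⊆-antisym
        (λ v∈ → let v∉R , v∈RS = x∈p∩q⁻ (∁ R) (R ∪ S) v∈ in
          Sum.[ (λ v∈R → contradiction v∈R (x∈∁p⇒x∉p v∉R)) , (λ v∈S → v∈S) ] (x∈p∪q⁻ R S v∈RS))
        (λ v∈S → x∈p∩q⁺ (x∉p⇒x∈∁p (λ v∈R → avoids v∈R v∈S) , x∈p∪q⁺ (inj₂ v∈S)))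
    where
    open Reach (reach S Y)
    sides : ∀ u v → Close G u v → (u ∈ ∁ R × v ∈ ∁ R) ⊎ (u ∈ R ∪ S × v ∈ R ∪ S)
    sides u v close with u ∈? R | v ∈? R | close
    ... | no u∉  | no v∉  | _         = inj₁ (x∉p⇒x∈∁p u∉ , x∉p⇒x∈∁p v∉)
    ... | yes u∈ | yes v∈ | _         = inj₂ (x∈p∪q⁺ (inj₁ u∈) , x∈p∪q⁺ (inj₁ v∈))
    ... | yes u∈ | no _   | inj₂ e    = inj₂ (x∈p∪q⁺ (inj₁ u∈) , x∈p∪q⁺ (closed u∈ e))
    ... | no _   | yes v∈ | inj₂ e    = inj₂ (x∈p∪q⁺ (closed v∈ (Graph.sym G e)) , x∈p∪q⁺ (inj₁ v∈))
    ... | yes u∈ | no u∉  | inj₁ refl = contradiction u∈ u∉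
    ... | no u∉  | yes u∈ | inj₁ refl = contradiction u∈ u∉
    X⊆ : X ⊆ ∁ R
    X⊆ {x} x∈X with x ∈? R
    ... | no  x∉R = x∉p⇒x∈∁p x∉R
    ... | yes x∈R with path x∈R
    ...   | _ , y∈ , p , isp , within with find∈ (separates x∈X y∈ p isp)
    ...     | w , w∈p , w∈S = contradiction w∈S (avoids (within w w∈p))
    Y⊆ : Y ⊆ R ∪ S
    Y⊆ y∈ = x∈p∪q⁺ (start y∈)

-- Blocks

module _ (k : ℕ) {n : ℕ} (G : Graph n) where

  -- If `X` lay on neither side, a vertex of `X` outside the first side and one outside the second
  -- would be separated by the small separator.
  inseparable⇒oriented : ∀ {X} → IsInseparableSet k G X → Oriented k G X
  inseparable⇒oriented {X} (k≤ , inseparable) = k≤ , side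
    where
    side : ∀ s → IsSeparation G s → order s < k → X ⊆ proj₁ s ⊎ X ⊆ proj₂ s
    side s sep small with X ⊆? proj₁ s | X ⊆? proj₂ s
    ... | yes X⊆A | _       = inj₁ X⊆A
    ... | no  _   | yes X⊆B = inj₂ X⊆B
    ... | no X⊈A  | no X⊈B with ⊈⇒∃ X⊈A | ⊈⇒∃ X⊈B
    ...   | x , x∈X , x∉A | y , y∈X , y∉B = ⊥-elim (inseparable y∈X x∈X (λ { refl → x∉A y∈A })
      ( proj₁ s ∩ proj₂ s , small
      , (λ y∈ → y∉B (p∩q⊆q (proj₁ s) (proj₂ s) y∈)) , (λ x∈ → x∉A (p∩q⊆p (proj₁ s) (proj₂ s) x∈))
      , split⇒separates (sep , ⁅x⁆⊆ y∈A , ⁅x⁆⊆ x∈B) ))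
      where
      y∈A : y ∈ proj₁ s
      y∈A = Sum.[ (λ y∈A → y∈A) , (λ y∈B → contradiction y∈B y∉B) ] (separation-cover sep y)
      x∈B : x ∈ proj₂ s
      x∈B = Sum.[ (λ x∈A → contradiction x∈A x∉A) , (λ x∈B → x∈B) ] (separation-cover sep x)

  oriented⇒inseparable : ∀ {X} → Oriented k G X → IsInseparableSet k G X
  oriented⇒inseparable {X} (k≤ , side) = k≤ , inseparable
    where
    inseparable : ∀ {x y} → x ∈ X → y ∈ X → x ≢ y → Inseparable k G x y
    inseparable {x} {y} x∈X y∈X _ (S , small , x∉S , y∉S , separates)
      with separates⇒split separates
    ... | s , (sep , x⊆A , y⊆B) , refl with side s sep small
    ...   | inj₁ X⊆A = y∉S (x∈p∩q⁺ (X⊆A y∈X , y⊆B (x∈⁅x⁆ y)))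
    ...   | inj₂ X⊆B = x∉S (x∈p∩q⁺ (x⊆A (x∈⁅x⁆ x) , X⊆B x∈X))

  -- If no small separation split the blocks, their union would be inseparable, and maximality would
  -- make both equal to it.
  blocks-split : ∀ {X Y} → IsBlock k G X → IsBlock k G Y → X ≢ Y → ∃[ s ] Split G X Y s × order s < k
  blocks-split {X} {Y} (insX , maxX) (insY , maxY) X≢Y
    with any-pair? (λ s → split? G X Y s ×-dec order s <? k)
  ... | yes found = found
  ... | no  none  = contradiction (trans (sym (maxX _ insXY (p⊆p∪q Y))) (maxY _ insXY (q⊆p∪q X Y))) X≢Y
    where
    side : ∀ s → IsSeparation G s → order s < k → X ∪ Y ⊆ proj₁ s ⊎ X ∪ Y ⊆ proj₂ s
    side s sep small
      with proj₂ (inseparable⇒oriented insX) s sep small | proj₂ (inseparable⇒oriented insY) s sep small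
    ... | inj₁ X⊆A | inj₁ Y⊆A = inj₁ (∪-lub X⊆A Y⊆A)
    ... | inj₂ X⊆B | inj₂ Y⊆B = inj₂ (∪-lub X⊆B Y⊆B)
    ... | inj₁ X⊆A | inj₂ Y⊆B = ⊥-elim (none (s , (sep , X⊆A , Y⊆B) , small))
    ... | inj₂ X⊆B | inj₁ Y⊆A = ⊥-elim (none
      (s ⋆ , (separation-⋆ sep , X⊆B , Y⊆A) , subst (_< k) (sym (order-⋆ s)) small))
    insXY : IsInseparableSet k G (X ∪ Y)
    insXY = oriented⇒inseparable (≤-trans (proj₁ insX) (∣p∣≤∣p∪q∣ X Y) , side)

  oriented-⊈ : ∀ {X A B} → Oriented k G X → ∣ A ∩ B ∣ < k → X ⊆ A → ¬ X ⊆ B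
  oriented-⊈ (k≤ , _) small X⊆A X⊆B = <⇒≱ small
    (≤-trans k≤ (p⊆q⇒∣p∣≤∣q∣ λ x∈ → x∈p∩q⁺ (X⊆A x∈ , X⊆B x∈)))

  data Chosen (s : Pair n) : Set where
    distinguishing : ∀ X Y → LeastDistinguishing k G X Y s → Chosen s
    detaching      : ∀ X C Z → LeastDetaching k G X C Z s → Chosen s
    detaching-⋆    : ∀ X C Z → LeastDetaching k G X C Z (s ⋆) → Chosen s

  chosen? : Decidable Chosen
  chosen? s = map′
    (λ where
      (inj₁ (X , Y , L))            → distinguishing X Y L
      (inj₂ (X , C , Z , inj₁ L))   → detaching X C Z L
      (inj₂ (X , C , Z , inj₂ L))   → detaching-⋆ X C Z L)
    (λ where
      (distinguishing X Y L)  → inj₁ (X , Y , L)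
      (detaching X C Z L)     → inj₂ (X , C , Z , inj₁ L)
      (detaching-⋆ X C Z L)   → inj₂ (X , C , Z , inj₂ L))
    ((anySubset? λ X → anySubset? λ Y → least? (distinguishes? k G X Y) s) ⊎-dec
     (anySubset? λ X → anySubset? λ C → anySubset? λ Z →
       least? (detaches? k G X C Z) s ⊎-dec least? (detaches? k G X C Z) (s ⋆)))

  chosen-⋆ : ∀ {s} → Chosen s → Chosen (s ⋆)
  chosen-⋆ (distinguishing X Y L) = distinguishing Y X (leastDistinguishing-⋆ k G L)
  chosen-⋆ (detaching X C Z L)    = detaching-⋆ X C Z L
  chosen-⋆ (detaching-⋆ X C Z L)  = detaching X C Z L

  chosen-nested : ∀ {s t} → Chosen s → Chosen t → Nested s t
  chosen-nested (distinguishing _ _ L) (distinguishing _ _ L′) = distinguishing-nested k G L L′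
  chosen-nested (distinguishing _ _ L) (detaching _ _ _ L′)    = nested-sym (detaching-distinguishing-nested k G L′ L)
  chosen-nested (distinguishing _ _ L) (detaching-⋆ _ _ _ L′)  =
    nested-⋆ʳ (nested-sym (detaching-distinguishing-nested k G L′ L))
  chosen-nested (detaching _ _ _ L)   (distinguishing _ _ L′)  = detaching-distinguishing-nested k G L L′
  chosen-nested (detaching _ _ _ L)   (detaching _ _ _ L′)     = detaching-nested k G L L′
  chosen-nested (detaching _ _ _ L)   (detaching-⋆ _ _ _ L′)   = nested-⋆ʳ (detaching-nested k G L L′)
  chosen-nested (detaching-⋆ _ _ _ L) (distinguishing _ _ L′)  =
    nested-⋆ˡ (detaching-distinguishing-nested k G L L′)
  chosen-nested (detaching-⋆ _ _ _ L) (detaching _ _ _ L′)     = nested-⋆ˡ (detaching-nested k G L L′)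
  chosen-nested (detaching-⋆ _ _ _ L) (detaching-⋆ _ _ _ L′)   = nested-⋆ˡ (nested-⋆ʳ (detaching-nested k G L L′))

  chosen-separation : ∀ {s} → Chosen s → IsSeparation G s × order s < k
  chosen-separation (distinguishing _ _ L) = let open Distinguishes (Least.member L) in separation , order<k
  chosen-separation (detaching _ _ _ L)    = let open Detaches (Least.member L) in separation , order<k
  chosen-separation {s} (detaching-⋆ _ _ _ L)  = let open Detaches (Least.member L) in
    separation-⋆ separation , subst (_< k) (order-⋆ s) order<k

  chosen-proper : ∀ {s} → Chosen s → ¬ proj₁ s ⊆ proj₂ s
  chosen-proper (distinguishing _ _ L) A⊆B =
    let open Distinguishes (Least.member L) in oriented-⊈ orientedˡ order<k left⊆ (⊆-trans left⊆ A⊆B)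
  chosen-proper (detaching _ _ _ L) A⊆B =
    let open Detaches (Least.member L) ; u , u∈C = nonempty in C∉ u∈C (A⊆B (C⊆ u∈C))
  chosen-proper {s} (detaching-⋆ _ _ _ L) A⊆B =
    let open Detaches (Least.member L) in
    oriented-⊈ oriented (subst (_< k) (order-⋆ s) order<k) X⊆ (⊆-trans X⊆ A⊆B)

  abstract

    chosen : NestedSet G
    chosen = record
      { N = Chosen ; N? = chosen? ; N-⋆ = chosen-⋆ ; nested = chosen-nested
      ; proper = chosen-proper ; separation = proj₁ ∘ chosen-separation }

    chosen⁺ : ∀ {s} → Chosen s → NestedSet.N chosen s
    chosen⁺ Cs = Cs

    chosen⁻ : ∀ {s} → NestedSet.N chosen s → Chosen s
    chosen⁻ Cs = Cs

  oriented-sided : ∀ {X s} → Oriented k G X → Chosen s → X ⊆ proj₁ s ⊎ X ⊆ proj₂ s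
  oriented-sided (_ , side) Cs = let sep , small = chosen-separation Cs in side _ sep small

-- Invariance under automorphisms

module _ {n : ℕ} {G : Graph n} where

  separation-act : ∀ α → IsAutomorphism G α → ∀ {s} → IsSeparation G s → IsSeparation G (act α s)
  separation-act α aut sep = mkSeparation λ u v close →
    Sum.map both both (together sep _ _ (Sum.map (cong (α ⟨$⟩ˡ_)) pull close))
    where
    pull : ∀ {u v} → Adj G u v → Adj G (α ⟨$⟩ˡ u) (α ⟨$⟩ˡ v)
    pull {u} {v} = Equivalence.to (flip-automorphism {G = G} {α} aut u v)
    both : ∀ {A u v} → α ⟨$⟩ˡ u ∈ A × α ⟨$⟩ˡ v ∈ A → u ∈ image α A × v ∈ image α A
    both (u∈ , v∈) = ∈-image⁺ α u∈ , ∈-image⁺ α v∈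

  module _ {k : ℕ} (α : Permutation′ n) (aut : IsAutomorphism G α) where
    private
      α⁻¹ : Permutation′ n
      α⁻¹ = Perm.flip α
      aut⁻¹ : IsAutomorphism G α⁻¹
      aut⁻¹ = flip-automorphism {G = G} {α} aut

    oriented-act : ∀ {X} → Oriented k G X → Oriented k G (image α X)
    oriented-act {X} (k≤ , side) = subst (k ≤_) (sym (∣image∣ α X)) k≤ , λ s sep small →
      Sum.map (image-⊆ α) (image-⊆ α)
        (side (act α⁻¹ s) (separation-act α⁻¹ aut⁻¹ sep) (subst (_< k) (sym (order-act α⁻¹ s)) small))

    distinguishes-act : ∀ {X Y s} → Distinguishes k G X Y s →
                        Distinguishes k G (image α X) (image α Y) (act α s)
    distinguishes-act {s = s} E = record
      { orientedˡ = oriented-act orientedˡ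
      ; orientedʳ = oriented-act orientedʳ
      ; split     = separation-act α aut separation , image-mono α left⊆ , image-mono α right⊆
      ; order<k   = subst (_< k) (sym (order-act α s)) order<k
      ; minimal   = λ u (sep , X⊆ , Y⊆) → subst₂ _≤_ (sym (order-act α s)) (order-act α⁻¹ u)
          (minimal (act α⁻¹ u) (separation-act α⁻¹ aut⁻¹ sep , ⊆-image α⁻¹ X⊆ , ⊆-image α⁻¹ Y⊆)) }
      where open Distinguishes E

    detaches-act : ∀ {X C Z s} → Detaches k G X C Z s →
                   Detaches k G (image α X) (image α C) (image α Z) (act α s)
    detaches-act {X} {C} {Z} {s} D = record
      { oriented   = oriented-act oriented
      ; uncut      = λ t sep avoids → Sum.map (image-⊆ α) (image-⊆ α)
          (uncut (act α⁻¹ t) (separation-act α⁻¹ aut⁻¹ sep) λ {v} v∈ →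
            let v∈C , v∈S = x∈p∩q⁻ C _ v∈
                v∈A , v∈B = x∈p∩q⁻ (image α⁻¹ (proj₁ t)) (image α⁻¹ (proj₂ t)) v∈S in
            contradiction
              (avoids (x∈p∩q⁺ (∈-image α v∈C , x∈p∩q⁺ (∈-image⁻ α⁻¹ v∈A , ∈-image⁻ α⁻¹ v∈B)))) ∉⊥)
      ; nonempty   = let u , u∈C = nonempty in α ⟨$⟩ʳ u , ∈-image α u∈C
      ; Z⊆X        = image-mono α Z⊆X
      ; ∣Z∣<k      = subst (_< k) (sym (∣image∣ α Z)) ∣Z∣<k
      ; neighbour  = λ z z∈ → let u , u∈C , e = neighbour _ (∈-image⁻ α z∈) in
          α ⟨$⟩ʳ u , ∈-image α u∈C , subst (Adj G _) (inverseʳ α) (Equivalence.to (aut _ _) e)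
      ; separation = separation-act α aut separation
      ; C⊆         = image-mono α C⊆
      ; C∩         = λ v∈ → let v∈C , v∈B = x∈p∩q⁻ (image α C) (image α (proj₂ s)) v∈ in
          contradiction (∈-image⁻ α v∈B) (C∉ (∈-image⁻ α v∈C))
      ; X⊆         = image-mono α X⊆
      ; separator⊆ = λ v∈ → let v∈A , v∈B = x∈p∩q⁻ (image α (proj₁ s)) (image α (proj₂ s)) v∈ in
          ∈-image⁺ α (separator∈Z (∈-image⁻ α v∈A) (∈-image⁻ α v∈B)) }
      where open Detaches D

  module _ {k : ℕ} (α : Permutation′ n) (aut : IsAutomorphism G α) where
    private
      aut⁻¹ : IsAutomorphism G (Perm.flip α)
      aut⁻¹ = flip-automorphism {G = G} {α} aut

    leastDetaching-act : ∀ {X C Z s} → LeastDetaching k G X C Z s →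
                         LeastDetaching k G (image α X) (image α C) (image α Z) (act α s)
    leastDetaching-act {X} {C} {Z} = least-act α (detaches-act α aut) back
      where
      back : ∀ {u} → Detaches k G (image α X) (image α C) (image α Z) u →
             Detaches k G X C Z (act (Perm.flip α) u)
      back {u} D = subst (λ (X , C , Z) → Detaches k G X C Z (act (Perm.flip α) u))
        (cong₂ _,_ (image-inverse (Perm.flip α) X)
          (cong₂ _,_ (image-inverse (Perm.flip α) C) (image-inverse (Perm.flip α) Z)))
        (detaches-act (Perm.flip α) aut⁻¹ D)

    leastDistinguishing-act : ∀ {X Y s} → LeastDistinguishing k G X Y s →
                              LeastDistinguishing k G (image α X) (image α Y) (act α s)
    leastDistinguishing-act {X} {Y} = least-act α (distinguishes-act α aut) λ {u} E →
      subst₂ (λ X Y → Distinguishes k G X Y (act (Perm.flip α) u))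
        (image-inverse (Perm.flip α) X) (image-inverse (Perm.flip α) Y)
        (distinguishes-act (Perm.flip α) aut⁻¹ E)

    chosen-act : ∀ {s} → Chosen k G s → Chosen k G (act α s)
    chosen-act (distinguishing _ _ L) = distinguishing _ _ (leastDistinguishing-act L)
    chosen-act (detaching _ _ _ L)    = detaching _ _ _ (leastDetaching-act L)
    chosen-act (detaching-⋆ _ _ _ L)  = detaching-⋆ _ _ _ (leastDetaching-act L)

-- Blocks that are parts

module _ {n : ℕ} {G : Graph n} (D : TreeDecomposition G) where
  open TreeDecomposition D

  -- Walks of G - V_t lift to walks of the tree avoiding t, so they stay beyond the edge tt′.
  module _ {t t′ : Fin size} (tt′ : Adj tree t t′) where

    Beyond : Fin size → Set
    Beyond r = Σ[ p ∈ Walk tree t′ r ] ¬ t List.∈ vertices p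

    -- If the tree path from `r` to `q` passed through `t`, then `w` would lie in `part t`.
    beyond-share : ∀ {r q w} → Beyond r → w ∈ part r → w ∈ part q → w ∉ part t → Beyond q
    beyond-share {r} {q} {w} (p , t∉p) w∈r w∈q w∉t = p ++ʷ walk , λ t∈ →
      Sum.[ t∉p , (λ t∈walk → w∉t (connected walk isPath t∈walk (x∈p∩q⁺ (w∈r , w∈q)))) ]
        (∈-++ʷ p walk t∈)
      where open Shortcut (toPath (IsTree.connected isTree r q))

    beyond-adj : ∀ {u w} → ∃[ r ] w ∈ part r × Beyond r → w ∉ part t → Adj G u w →
                 ∃[ q ] u ∈ part q × w ∈ part q × Beyond q
    beyond-adj (r , w∈r , beyond) w∉t e =
      let q , u∈q , w∈q = coverE e in q , u∈q , w∈q , beyond-share beyond w∈r w∈q w∉t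

    beyond-walk : ∀ {u v} (p : Walk G u v) → (∀ w → w List.∈ vertices p → w ∉ part t) →
                  ∃[ r ] v ∈ part r × Beyond r → ∃[ r ] u ∈ part r × Beyond r
    beyond-walk [ _ ]      outside start = start
    beyond-walk (step e p) outside start =
      let q , u∈q , _ , beyond = beyond-adj (beyond-walk p (λ w w∈ → outside w (there w∈)) start)
                                            (outside _ (there (first∈ p))) e
      in q , u∈q , beyond

    -- The path from `t` to `q` passes through `t′`.
    beyond∩⊆ : ∀ {q z} → Beyond q → z ∈ part t → z ∈ part q → z ∈ part t′
    beyond∩⊆ {q} (p , t∉p) z∈t z∈q = connected (step tt′ walk)
      (All.tabulate (λ w∈ t≡w → t∉p (within (subst (List._∈ vertices walk) (sym t≡w) w∈))) ∷ isPath)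
      (there (first∈ walk)) (x∈p∩q⁺ (z∈t , z∈q))
      where open Shortcut (toPath p)

  module _ {k : ℕ} (adhesion : HasAdhesionBelow D k) {t : Fin size} where

    -- A component of G - V_t attaches to V_t inside one adhesion set.
    attachment<k : ∀ {v} → v ∉ part t → (C Z : Subset n) → Z ⊆ part t →
      (∀ {u} → u ∈ C → Σ[ p ∈ Walk G u v ] (∀ w → w List.∈ vertices p → w ∉ part t)) →
      (∀ z → z ∈ Z → ∃[ u ] u ∈ C × Adj G u z) → ∣ Z ∣ < k
    attachment<k {v} v∉t C Z Z⊆ path neighbour with coverV v
    ... | r , v∈r with toPath (IsTree.connected isTree t r)
    ...   | record { walk = [ _ ] } = contradiction v∈r v∉t
    ...   | record { walk = step {v = t′} tt′ p ; isPath = t∉ ∷ _ } =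
      ≤-<-trans (p⊆q⇒∣p∣≤∣q∣ Z⊆adhesion) (adhesion tt′)
      where
      start : ∃[ r ] v ∈ part r × Beyond tt′ r
      start = r , v∈r , p , λ t∈ → All.lookup t∉ t∈ refl
      Z⊆adhesion : Z ⊆ part t ∩ part t′
      Z⊆adhesion {z} z∈Z with neighbour z z∈Z
      ... | u , u∈C , e with path u∈C
      ...   | walk , outside
        with beyond-adj tt′ (beyond-walk tt′ walk outside start) (outside u (first∈ walk)) (Graph.sym G e)
      ...     | q , z∈q , _ , beyond = x∈p∩q⁺ (Z⊆ z∈Z , beyond∩⊆ tt′ beyond (Z⊆ z∈Z) z∈q)

module _ (k : ℕ) {n : ℕ} (G : Graph n) where

  -- `C` is the component of `G - X` containing `v`, and `Z` is its neighbourhood; the separation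
  -- `(C ∪ Z , ∁ C)` shows that the family is nonempty.
  detach-from-part : (D : TreeDecomposition G) → HasAdhesionBelow D k → ∀ {X} → IsPart D X →
                     Oriented k G X → ∀ v → v ∉ X →
                     ∃[ C ] ∃[ Z ] v ∈ C × (∃[ s ] Detaches k G X C Z s)
  detach-from-part D adhesion {X} (t , refl) oriented v v∉X =
    C , Z , v∈C , (C ∪ Z , ∁ C) , record
      { oriented   = oriented
      ; uncut      = uncut
      ; nonempty   = v , v∈C
      ; Z⊆X        = Z⊆X
      ; ∣Z∣<k      = attachment<k D adhesion v∉X C Z Z⊆X walk (λ z → proj₂ ∘ Z⁻)
      ; neighbour  = λ z → proj₂ ∘ Z⁻
      ; separation = mkSeparation sides
      ; C⊆         = p⊆p∪q Z
      ; C∩         = λ u∈ → contradiction (p∩q⊆p C (∁ C) u∈) (x∈∁p⇒x∉p (p∩q⊆q C (∁ C) u∈))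
      ; X⊆         = λ x∈X → x∉p⇒x∈∁p λ x∈C → avoids x∈C x∈X
      ; separator⊆ = λ u∈ → let u∈CZ , u∈∁C = x∈p∩q⁻ (C ∪ Z) (∁ C) u∈ in
          Sum.[ (λ u∈C → contradiction u∈C (x∈∁p⇒x∉p u∈∁C)) , (λ u∈Z → u∈Z) ] (x∈p∪q⁻ C Z u∈CZ)
      }
    where
    open Reach (reach {G = G} X ⁅ v ⁆) renaming (R to C)
    attached? : Decidable (λ z → z ∈ X × ∃[ u ] u ∈ C × Adj G u z)
    attached? z = z ∈? X ×-dec Fin.any? λ u → u ∈? C ×-dec Graph.adj? G u z
    Z : Subset n
    Z = comprehension attached?
    Z⁻ : ∀ {z} → z ∈ Z → z ∈ X × ∃[ u ] u ∈ C × Adj G u z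
    Z⁻ = ∈-comprehension⁻ attached?
    Z⊆X : Z ⊆ X
    Z⊆X z∈ = proj₁ (Z⁻ z∈)
    v∈C : v ∈ C
    v∈C = Sum.[ (λ v∈C → v∈C) , (λ v∈X → contradiction v∈X v∉X) ]′ (start (x∈⁅x⁆ v))
    pathTo : ∀ {u} → u ∈ C → Σ[ p ∈ Walk G u v ] (∀ w → w List.∈ vertices p → w ∈ C)
    pathTo u∈C with path u∈C
    ... | y , y∈ , p , _ , within with refl ← x∈⁅y⁆⇒x≡y v y∈ = p , within
    walk : ∀ {u} → u ∈ C → Σ[ p ∈ Walk G u v ] (∀ w → w List.∈ vertices p → w ∉ X)
    walk u∈C = let p , within = pathTo u∈C in p , λ w w∈ → avoids (within w w∈)
    enter : ∀ {u w} → u ∈ C → Adj G u w → w ∈ C ∪ Z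
    enter {u} u∈C e with closed u∈C e
    ... | inj₁ w∈C = x∈p∪q⁺ (inj₁ w∈C)
    ... | inj₂ w∈X = x∈p∪q⁺ (inj₂ (∈-comprehension⁺ attached? (w∈X , u , u∈C , e)))
    sides : ∀ u w → Close G u w → (u ∈ C ∪ Z × w ∈ C ∪ Z) ⊎ (u ∈ ∁ C × w ∈ ∁ C)
    sides u w close with u ∈? C | w ∈? C | close
    ... | no u∉  | no w∉  | _         = inj₂ (x∉p⇒x∈∁p u∉ , x∉p⇒x∈∁p w∉)
    ... | yes u∈ | _      | inj₁ refl = inj₁ (p⊆p∪q Z u∈ , p⊆p∪q Z u∈)
    ... | no u∉  | yes u∈ | inj₁ refl = contradiction u∈ u∉
    ... | yes u∈ | _      | inj₂ e    = inj₁ (p⊆p∪q Z u∈ , enter u∈ e)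
    ... | no _   | yes w∈ | inj₂ e    = inj₁ (enter w∈ (Graph.sym G e) , p⊆p∪q Z w∈)
    -- The side of `v` spreads along walks inside `C`, because these never meet the separator.
    uncut : Uncut G C
    uncut s sep avoid = Sum.map (spread sep avoid) (spread (separation-⋆ sep)
        (λ u∈ → avoid (subst (λ S → _ ∈ C ∩ S) (∩-comm (proj₂ s) (proj₁ s)) u∈)))
      (separation-cover sep v)
      where
      spread : ∀ {s} → IsSeparation G s → C ∩ (proj₁ s ∩ proj₂ s) ⊆ ⊥ → v ∈ proj₁ s → C ⊆ proj₁ s
      spread {s} sep avoid v∈A u∈C = let p , within = pathTo u∈C in along p within
        where
        along : ∀ {u} (p : Walk G u v) → (∀ w → w List.∈ vertices p → w ∈ C) → u ∈ proj₁ s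
        along [ _ ]      within = v∈A
        along (step e p) within with along p (λ w w∈ → within w (there w∈)) | together sep _ _ (inj₂ e)
        ... | _   | inj₁ (u∈A , _) = u∈A
        ... | w∈A | inj₂ (_ , w∈B) = contradiction
          (avoid (x∈p∩q⁺ (within _ (there (first∈ p)) , x∈p∩q⁺ (w∈A , w∈B)))) ∉⊥

  -- Two successive minimisations: first of the order, to get a member of the family, then of the
  -- crossings within the family.
  leastDistinguishing-exists : ∀ {X Y} → Oriented k G X → Oriented k G Y →
    (∃[ s ] Split G X Y s × order s < k) → ∃[ s ] LeastDistinguishing k G X Y s
  leastDistinguishing-exists {X} {Y} oX oY (u , split-u , small)
    with argmin order (λ m → any-pair? λ s → split? G X Y s ×-dec order s <? m) (u , split-u)
  ... | s , split-s , minimal = least-exists (distinguishes? k G X Y) (s , record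
    { orientedˡ = oX ; orientedʳ = oY ; split = split-s
    ; order<k = ≤-<-trans (minimal u split-u) small ; minimal = minimal })

-- The good tree-decomposition

module _ (k : ℕ) {n : ℕ} (G : Graph n) where
  open Tree (chosen k G)
  open TreeSymmetry (chosen k G)

  sided : ∀ {X} → Oriented k G X → Sided X
  sided oX Ns = oriented-sided k G oX (chosen⁻ k G Ns)

  module _ {X Y s} (L : LeastDistinguishing k G X Y s) where
    private
      open Distinguishes (Least.member L)

      small⋆ : ∣ proj₂ s ∩ proj₁ s ∣ < k
      small⋆ = subst (_< k) (sym (order-⋆ s)) order<k

      edge : ∃[ i ] ∃[ j ] FlipEdge (s ⋆) i j × OnDifferentSides treeDecomposition i j X Y
      edge = separated (sided orientedˡ) (sided orientedʳ) (chosen⁺ k G (distinguishing X Y L))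
        left⊆ (oriented-⊈ k G orientedˡ order<k left⊆)
        right⊆ (oriented-⊈ k G orientedʳ small⋆ right⊆)

      efficient : ∀ S → ∃[ u ] Split G X Y u × proj₁ u ∩ proj₂ u ≡ S → order s ≤ ∣ S ∣
      efficient S (u , split-u , refl) = minimal u split-u

    distinguished : DistinguishesEfficiently treeDecomposition X Y
    distinguished =
      let i , j , f , sides = edge
          adhesion≡ = trans (flipEdge-adhesion f) (∩-comm (proj₂ s) (proj₁ s)) in
      i , j , (_ , f) , sides ,
      subst (λ S → Separates G S X Y) (sym adhesion≡) (split⇒separates split) ,
      λ S separates → subst (λ S′ → ∣ S′ ∣ ≤ ∣ S ∣) (sym adhesion≡) (efficient S (separates⇒split separates))

  blocks-distinguished : ∀ {X Y} → IsBlock k G X → IsBlock k G Y → X ≢ Y →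
                         DistinguishesEfficiently treeDecomposition X Y
  blocks-distinguished bX bY X≢Y = distinguished (proj₂ (leastDistinguishing-exists k G
    (inseparable⇒oriented k G (proj₁ bX)) (inseparable⇒oriented k G (proj₁ bY))
    (blocks-split k G bX bY X≢Y)))

  part-displayed : ∀ X → IsBlock k G X →
    (Σ[ D ∈ TreeDecomposition G ] (HasAdhesionBelow D k × IsPart D X)) → IsPart treeDecomposition X
  part-displayed X bX (D , adhesion , isPart) = towards (sided oX) , part-towards-≡ (sided oX) cut-off
    where
    oX : Oriented k G X
    oX = inseparable⇒oriented k G (proj₁ bX)
    cut-off : ∀ v → v ∉ X → ∃[ s ] NestedSet.N (chosen k G) s × X ⊆ proj₂ s × ¬ X ⊆ proj₁ s × v ∉ proj₂ s
    cut-off v v∉X with detach-from-part k G D adhesion isPart oX v v∉X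
    ... | C , Z , v∈C , some with least-exists (detaches? k G X C Z) some
    ...   | s , L = let open Detaches (Least.member L) in
      s , chosen⁺ k G (detaching X C Z L) , X⊆ ,
      oriented-⊈ k G oX (subst (_< k) (sym (order-⋆ s)) order<k) X⊆ , C∉ v∈C

corollary3p3 : ∀ (k : ℕ) → 1 ≤ k → ∀ {n : ℕ} (G : Graph n) →
    Σ[ D ∈ TreeDecomposition G ]
    IsGood D k ×
    (∀ X → IsBlock k G X →
    (Σ[ D′ ∈ TreeDecomposition G ] (HasAdhesionBelow D′ k × IsPart D′ X)) →
    IsPart D X)
corollary3p3 k _ G = treeDecomposition , record
  { canonical     = canonical λ α aut Ns → chosen⁺ k G (chosen-act α aut (chosen⁻ k G Ns))
  ; adhesion      = adhesion<k λ Ns → proj₂ (chosen-separation k G (chosen⁻ k G Ns))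
  ; distinguishes = blocks-distinguished k G
  } , part-displayed k G
  where
  open Tree (chosen k G)
  open TreeSymmetry (chosen k G)
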